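{- Let $G$ be a block graph that is $\mathcal{T}_3$-free, i.e. $G$ has no induced subgraph isomorphic to the graph $\mathcal{T}_3$. Then the $3$-independence complex $\mathrm{Ind}_3(G)$ is shellable.
   Context: All graphs are finite and simple. A block of a graph is a maximal connected subgraph that remains connected after removal of any single vertex; $G$ is a block graph if every block is a complete graph. The graph $\mathcal{T}_3$ has vertex set $\{x_1,\dots,x_9\}$ and edge set $\{x_1x_2, x_2x_3, x_3x_4, x_3x_5, x_4x_5, x_5x_6, x_6x_7, x_4x_8, x_8x_9\}$ (a triangle $x_3x_4x_5$ with a path of length two attached at each of its three vertices). For $r \geq 1$, a subset $A \subseteq V(G)$ is $r$-independent if every connected component of $G[A]$ has at most $r$ vertices; $\mathrm{Ind}_r(G)$ is the simplicial complex on $V(G)$ of all $r$-independent subsets. A (not necessarily pure) simplicial complex is shellable if its facets can be ordered $F_1,\dots,F_t$ so that for each $k>1$, $\langle F_k\rangle \cap \langle F_1,\dots,F_{k-1}\rangle$ is pure of dimension $\dim F_k-1$ ($\langle\mathcal F\rangle$ = complex generated by $\mathcal F$). -}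

module Defs where

open import Data.Nat using (ℕ; zero; suc; _≤_; _∸_)
open import Data.Bool using (Bool; true; false; T)
open import Data.Fin using (Fin; zero; suc; _<_)
open import Data.Fin.Subset using (Subset; _∈_; _∉_; _⊆_; ∣_∣; _─_; ⁅_⁆)
open import Data.Product using (Σ; _×_; ∃; ∃-syntax; _,_)
open import Relation.Binary.PropositionalEquality using (_≡_)
open import Relation.Nullary using (¬_)
open import Function.Definitions using (Injective)

record Graph : Set where
  field
    n      : ℕ
    adj    : Fin n → Fin n → Bool
    sym    : ∀ u v → adj u v ≡ adj v u
    irrefl : ∀ u → adj u u ≡ false

open Graph public

Edge : (G : Graph) → Fin (n G) → Fin (n G) → Set
Edge G u v = T (adj G u v)

data Reach (G : Graph) (S : Subset (n G)) : Fin (n G) → Fin (n G) → Set where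
  here : ∀ {u} → u ∈ S → Reach G S u u
  step : ∀ {u w v} → Reach G S u w → Edge G w v → v ∈ S → Reach G S u v

Connected : (G : Graph) → Subset (n G) → Set
Connected G S = ∀ u v → u ∈ S → v ∈ S → Reach G S u v

TwoConn : (G : Graph) → Subset (n G) → Set
TwoConn G B = Connected G B × (∀ v → v ∈ B → Connected G (B ─ ⁅ v ⁆))

-- A block: a maximal vertex set B with the property above (a maximal subgraph
-- with this property is necessarily the induced subgraph on its vertex set).
IsBlock : (G : Graph) → Subset (n G) → Set
IsBlock G B = TwoConn G B × (∀ B′ → B ⊆ B′ → TwoConn G B′ → B′ ⊆ B)

IsClique : (G : Graph) → Subset (n G) → Set
IsClique G B = ∀ u v → u ∈ B → v ∈ B → ¬ (u ≡ v) → Edge G u v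

IsBlockGraph : Graph → Set
IsBlockGraph G = ∀ B → IsBlock G B → IsClique G B

-- The graph T₃ on Fin 9 (x₁..x₉ ↦ 0..8); edges
-- x1x2, x2x3, x3x4, x3x5, x4x5, x5x6, x6x7, x4x8, x8x9.
T3adj : Fin 9 → Fin 9 → Bool
T3adj i j = e (Data.Fin.toℕ i) (Data.Fin.toℕ j)
  where
  e0 : ℕ → ℕ → Bool
  e0 0 1 = true
  e0 1 2 = true
  e0 2 3 = true
  e0 2 4 = true
  e0 3 4 = true
  e0 4 5 = true
  e0 5 6 = true
  e0 3 7 = true
  e0 7 8 = true
  e0 _ _ = false
  e : ℕ → ℕ → Bool
  e a b = Data.Bool._∨_ (e0 a b) (e0 b a)

HasInducedT3 : Graph → Set
HasInducedT3 G = Σ (Fin 9 → Fin (n G)) λ f →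
  Injective _≡_ _≡_ f × (∀ i j → adj G (f i) (f j) ≡ T3adj i j)

T3Free : Graph → Set
T3Free G = ¬ HasInducedT3 G

-- A is r-independent: every connected component of G[A] has at most r vertices,
-- i.e. for every v ∈ A, every set C of vertices lying in the component of v in G[A]
-- has at most r elements.
RIndependent : (G : Graph) → ℕ → Subset (n G) → Set
RIndependent G r A = ∀ v → v ∈ A → ∀ (C : Subset (n G)) →
  (∀ u → u ∈ C → Reach G A v u) → ∣ C ∣ ≤ r

Ind : (G : Graph) → ℕ → Subset (n G) → Set
Ind G r = RIndependent G r

Complex : ℕ → Set₁
Complex m = Subset m → Set

IsFacet : ∀ {m} → Complex m → Subset m → Set
IsFacet K F = K F × (∀ σ → K σ → F ⊆ σ → σ ⊆ F)

-- K is pure of dimension d, where d+1 = s: every face has at most s vertices and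
-- every face lies in a face with exactly s vertices.
PureOfSize : ∀ {m} → Complex m → ℕ → Set
PureOfSize K s = (∀ σ → K σ → ∣ σ ∣ ≤ s) ×
                 (∀ σ → K σ → ∃[ τ ] (K τ × σ ⊆ τ × ∣ τ ∣ ≡ s))

PrefixMeet : ∀ {m t} → (Fin t → Subset m) → Fin t → Complex m
PrefixMeet F k σ = σ ⊆ F k × ∃[ j ] (j < k × σ ⊆ F j)

-- Shellable (not necessarily pure): an enumeration F_0,…,F_{t-1} of all facets
-- (each exactly once) such that for k > 0, ⟨F_k⟩ ∩ ⟨F_0..F_{k-1}⟩ is pure of
-- dimension dim F_k − 1, i.e. all its facets have ∣F_k∣ − 1 vertices.
Shellable : ∀ {m} → Complex m → Set
Shellable {m} K = ∃[ t ] Σ (Fin t → Subset m) λ F →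
  (∀ i → IsFacet K (F i)) ×
  (∀ σ → IsFacet K σ → ∃[ i ] F i ≡ σ) ×
  Injective _≡_ _≡_ F ×
  (∀ (k : Fin t) → 0 Data.Nat.< Data.Fin.toℕ k → PureOfSize (PrefixMeet F k) (∣ F k ∣ ∸ 1))

{-# OPTIONS --safe #-}

-- For 3-independence, a minor of Ind₃(G) is given by vertex sets W ⊆ H, its faces being the
-- 3-independent A with W ⊆ A ⊆ H. Following Woodroofe, the complex is shellable once every
-- minor with W ≠ H has a simplicial vertex v ∈ H ∖ W. To find v, take a longest induced path in
-- G[H] that ends outside W: everything below its end v then lies in W. If no vertex outside W
-- is simplicial, then v has a child d ∈ W, and two minimal non-faces violating simpliciality of
-- v reach two distinct vertices x, y outside W on the far side of v. They create a connected
-- 4-set inside a face, except in two situations. If v has a second descendant in W, one of x, y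
-- is a sibling of v with a single descendant in W, and the argument applies to it instead.
-- Otherwise the parent p of v, x and y may form a triangle; as x and y are not simplicial, paths
-- of length two leave it at all three corners, which is an induced T₃.

module Submission where

open import Defs
open import Data.Bool using (true; false; T; T?)
import Data.Bool as Bool
open import Data.Empty using (⊥; ⊥-elim)
open import Data.Fin using (Fin; zero; suc)
import Data.Fin as Fin
open import Data.Fin.Patterns
import Data.Fin.Properties as Fin
open import Data.Fin.Subset using (Subset; _∈_; _∉_; _⊆_; ∣_∣; _∪_; _∩_; _-_; ⁅_⁆)
  renaming (⊥ to ∅; ⊤ to full)
open import Data.Fin.Subset.Properties
open import Data.List using (List; []; _∷_; _++_; length; lookup; map)
open import Data.List.Membership.Propositional using () renaming (_∈_ to _∈ˡ_)
open import Data.List.Membership.Propositional.Properties using (∈-++⁺ˡ; ∈-++⁺ʳ; ∈-++⁻; ∈-map⁺; ∈-map⁻; ∈-lookup)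
open import Data.List.Relation.Unary.All using ([]; _∷_) renaming (lookup to All-lookup)
open import Data.List.Relation.Unary.AllPairs using ([]; _∷_)
open import Data.List.Relation.Unary.Any using (here; there)
import Data.List.Relation.Unary.Any as Any
open import Data.List.Relation.Unary.Unique.Propositional using (Unique)
import Data.List.Relation.Unary.Unique.Propositional.Properties as Unique
open import Data.Maybe using (Maybe; just; nothing)
open import Data.Nat using (ℕ; zero; suc; _+_; _∸_; _≤_; z≤n; s≤s)
import Data.Nat as ℕ
open import Data.Nat.Properties using (≤-refl; ≤-trans; ≤-reflexive; ≤-antisym; +-suc; +-identityʳ; +-monoˡ-≤; n≤1+n; m≤n+m; m+n≤o⇒m≤o; <⇒≱)
open import Data.Product using (∃-syntax; _×_; _,_; proj₁)
open import Data.Sum using (_⊎_; inj₁; inj₂; [_,_]′)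
open import Data.Unit using (⊤; tt)
open import Data.Vec using ([]; _∷_)
open import Data.Vec.Properties using (∷-injectiveʳ)
open import Function using (_∘_; id)
open import Relation.Binary using (tri<; tri≈; tri>)
open import Relation.Binary.PropositionalEquality using (_≡_; _≢_; refl; trans; cong; subst) renaming (sym to ≡-sym)
open import Relation.Nullary using (¬_; Dec; yes; no; ¬?; _×-dec_; _⊎-dec_; _→-dec_; contradiction)
open import Relation.Nullary.Decidable using (map′; decidable-stable; toWitness)
open import Relation.Unary using (Decidable)

-- Finite subsets

infixl 6 _⊕_

_⊕_ : ∀ {m} → Subset m → Fin m → Subset m
A ⊕ x = A ∪ ⁅ x ⁆

module _ {m : ℕ} where

  ⊆⊕ : ∀ (A : Subset m) x → A ⊆ A ⊕ x
  ⊆⊕ A x = p⊆p∪q ⁅ x ⁆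

  ∈⊕ : ∀ (A : Subset m) x → x ∈ A ⊕ x
  ∈⊕ A x = q⊆p∪q A ⁅ x ⁆ (x∈⁅x⁆ x)

  ∈⊕⁻ : ∀ (A : Subset m) x {y} → y ∈ A ⊕ x → y ∈ A ⊎ y ≡ x
  ∈⊕⁻ A x y∈ with x∈p∪q⁻ A ⁅ x ⁆ y∈
  ... | inj₁ y∈A = inj₁ y∈A
  ... | inj₂ y∈x = inj₂ (x∈⁅y⁆⇒x≡y x y∈x)

  ⊕-least : ∀ {A B : Subset m} {x} → A ⊆ B → x ∈ B → A ⊕ x ⊆ B
  ⊕-least {A} {B} {x} A⊆B x∈B y∈ with ∈⊕⁻ A x y∈
  ... | inj₁ y∈A = A⊆B y∈A
  ... | inj₂ refl = x∈B

  ⊕-mono : ∀ {A B : Subset m} x → A ⊆ B → A ⊕ x ⊆ B ⊕ x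
  ⊕-mono {A} {B} x A⊆B = ⊕-least (λ y∈A → ⊆⊕ B x (A⊆B y∈A)) (∈⊕ B x)

  ∪-least : ∀ {A B C : Subset m} → A ⊆ C → B ⊆ C → A ∪ B ⊆ C
  ∪-least {A} {B} A⊆C B⊆C y∈ with x∈p∪q⁻ A B y∈
  ... | inj₁ y∈A = A⊆C y∈A
  ... | inj₂ y∈B = B⊆C y∈B

∉- : ∀ {m} (A : Subset m) x → x ∉ A - x
∉- (true ∷ A) zero ()
∉- (false ∷ A) zero ()
∉- (b ∷ A) (suc x) x∈ = ∉- A x (drop-there x∈)

module _ {m : ℕ} where

  -⊆ : ∀ (A : Subset m) x → A - x ⊆ A
  -⊆ A x = p─q⊆p A ⁅ x ⁆

  ∈-≢ : ∀ (A : Subset m) x {y} → y ∈ A - x → y ≢ x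
  ∈-≢ A x y∈ refl = ∉- A x y∈

  ⊆- : ∀ {A B : Subset m} {x} → A ⊆ B → x ∉ A → A ⊆ B - x
  ⊆- A⊆B x∉A y∈A = x∈p∧x≢y⇒x∈p-y (A⊆B y∈A) λ { refl → x∉A y∈A }

suc∣p-x∣≡∣p∣ : ∀ {m} {A : Subset m} {x} → x ∈ A → suc ∣ A - x ∣ ≡ ∣ A ∣
suc∣p-x∣≡∣p∣ {A = true ∷ A} {zero} _ = cong (suc ∘ ∣_∣) (p─⊥≡p A)
suc∣p-x∣≡∣p∣ {A = true ∷ A} {suc x} x∈ = cong suc (suc∣p-x∣≡∣p∣ (drop-there x∈))
suc∣p-x∣≡∣p∣ {A = false ∷ A} {suc x} x∈ = suc∣p-x∣≡∣p∣ (drop-there x∈)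
suc∣p-x∣≡∣p∣ {A = false ∷ A} {zero} ()

∣p⊕x∣≤1+∣p∣ : ∀ {m} (A : Subset m) x → ∣ A ⊕ x ∣ ≤ suc ∣ A ∣
∣p⊕x∣≤1+∣p∣ (true ∷ A) zero = s≤s (≤-trans (≤-reflexive (cong ∣_∣ (∪-identityʳ A))) (n≤1+n _))
∣p⊕x∣≤1+∣p∣ (false ∷ A) zero = s≤s (≤-reflexive (cong ∣_∣ (∪-identityʳ A)))
∣p⊕x∣≤1+∣p∣ (true ∷ A) (suc x) = s≤s (∣p⊕x∣≤1+∣p∣ A x)
∣p⊕x∣≤1+∣p∣ (false ∷ A) (suc x) = ∣p⊕x∣≤1+∣p∣ A x

1+∣p∣≤∣p⊕x∣ : ∀ {m} {A : Subset m} {x} → x ∉ A → suc ∣ A ∣ ≤ ∣ A ⊕ x ∣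
1+∣p∣≤∣p⊕x∣ {A = A} {x} x∉A = p⊂q⇒∣p∣<∣q∣ (⊆⊕ A x , x , ∈⊕ A x , x∉A)

allSubsets : ∀ m → List (Subset m)
allSubsets zero = [] ∷ []
allSubsets (suc m) = map (true ∷_) (allSubsets m) ++ map (false ∷_) (allSubsets m)

∈-allSubsets : ∀ {m} (A : Subset m) → A ∈ˡ allSubsets m
∈-allSubsets [] = here refl
∈-allSubsets (true ∷ A) = ∈-++⁺ˡ (∈-map⁺ (true ∷_) (∈-allSubsets A))
∈-allSubsets {suc m} (false ∷ A) = ∈-++⁺ʳ (map (true ∷_) (allSubsets m)) (∈-map⁺ (false ∷_) (∈-allSubsets A))

allSubsets-unique : ∀ m → Unique (allSubsets m)
allSubsets-unique zero = [] ∷ []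
allSubsets-unique (suc m) =
  Unique.++⁺ (Unique.map⁺ ∷-injectiveʳ (allSubsets-unique m))
             (Unique.map⁺ ∷-injectiveʳ (allSubsets-unique m))
             λ (p , q) → disjoint (∈-map⁻ (true ∷_) p) (∈-map⁻ (false ∷_) q)
  where
  disjoint : ∀ {A : Subset (suc m)} → ∃[ B ] (B ∈ˡ allSubsets m × A ≡ true ∷ B) →
             ∃[ B ] (B ∈ˡ allSubsets m × A ≡ false ∷ B) → ⊥
  disjoint (_ , _ , refl) (_ , _ , ())

-- Shelling orders

module _ {m : ℕ} where

  -- `P` holds of the facets listed before `F`. This is the exchange form of the shelling condition:
  -- `F ∩ E` lies in the ridge `F - w`, which some earlier facet contains.
  ShellStep : (Subset m → Set) → Subset m → Subset m → Set
  ShellStep P F E = ∃[ E′ ] ∃[ w ] (P E′ × w ∈ F × w ∉ E × F - w ⊆ E′)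

  -- The facets already listed enter as a predicate, so that shellings can be concatenated.
  IsShelling : (Subset m → Set) → List (Subset m) → Set
  IsShelling P [] = ⊤
  IsShelling P (F ∷ L) = (∀ E → P E → ShellStep P F E) × IsShelling (λ E → P E ⊎ E ≡ F) L

  shelling-resp : ∀ {P Q} L → (∀ {E} → P E → Q E) → (∀ {E} → Q E → P E) →
                  IsShelling P L → IsShelling Q L
  shelling-resp [] _ _ _ = tt
  shelling-resp (F ∷ L) P⇒Q Q⇒P (h , s) =
    (λ E q → let E′ , w , p , r = h E (Q⇒P q) in E′ , w , P⇒Q p , r) ,
    shelling-resp L [ inj₁ ∘ P⇒Q , inj₂ ]′ [ inj₁ ∘ Q⇒P , inj₂ ]′ s

  shelling-++ : ∀ {P} L₁ L₂ → IsShelling P L₁ → IsShelling (λ E → P E ⊎ E ∈ˡ L₁) L₂ →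
                IsShelling P (L₁ ++ L₂)
  shelling-++ [] L₂ _ s₂ = shelling-resp L₂ [ id , (λ ()) ]′ inj₁ s₂
  shelling-++ (F ∷ L₁) L₂ (h , s₁) s₂ = h , shelling-++ L₁ L₂ s₁ (shelling-resp L₂ to from s₂)
    where
    to : ∀ {E} → _ ⊎ E ∈ˡ F ∷ L₁ → (_ ⊎ E ≡ F) ⊎ E ∈ˡ L₁
    to (inj₁ p) = inj₁ (inj₁ p)
    to (inj₂ (here e)) = inj₁ (inj₂ e)
    to (inj₂ (there i)) = inj₂ i
    from : ∀ {E} → (_ ⊎ E ≡ F) ⊎ E ∈ˡ L₁ → _ ⊎ E ∈ˡ F ∷ L₁
    from (inj₁ (inj₁ p)) = inj₁ p
    from (inj₁ (inj₂ e)) = inj₂ (here e)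
    from (inj₂ i) = inj₂ (there i)

  -- For an earlier facet in `Q` the witness is again taken in `Q`; for any other the given shelling
  -- supplies it.
  shelling-prior : ∀ {P Q} L → (∀ F → F ∈ˡ L → ∀ E → Q E → ShellStep Q F E) →
                   IsShelling P L → IsShelling (λ E → Q E ⊎ P E) L
  shelling-prior [] _ _ = tt
  shelling-prior {P} {Q} (F ∷ L) hQ (h , s) =
    step′ , shelling-resp L to from (shelling-prior L (λ F i → hQ F (there i)) s)
    where
    step′ : ∀ E → Q E ⊎ P E → ShellStep (λ E → Q E ⊎ P E) F E
    step′ E (inj₁ q) = let E′ , w , q′ , r = hQ F (here refl) E q in E′ , w , inj₁ q′ , r
    step′ E (inj₂ p) = let E′ , w , p′ , r = h E p in E′ , w , inj₂ p′ , r
    to : ∀ {E} → Q E ⊎ (P E ⊎ E ≡ F) → (Q E ⊎ P E) ⊎ E ≡ F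
    to (inj₁ q) = inj₁ (inj₁ q)
    to (inj₂ (inj₁ p)) = inj₁ (inj₂ p)
    to (inj₂ (inj₂ e)) = inj₂ e
    from : ∀ {E} → (Q E ⊎ P E) ⊎ E ≡ F → Q E ⊎ (P E ⊎ E ≡ F)
    from (inj₁ (inj₁ q)) = inj₁ q
    from (inj₁ (inj₂ p)) = inj₂ (inj₁ p)
    from (inj₂ e) = inj₂ (inj₂ e)

  shelling-lookup : ∀ {P} L → IsShelling P L → ∀ k E → P E ⊎ (∃[ j ] (j Fin.< k × lookup L j ≡ E)) →
                    ShellStep (λ E → P E ⊎ (∃[ j ] (j Fin.< k × lookup L j ≡ E))) (lookup L k) E
  shelling-lookup (F ∷ L) (h , s) zero E (inj₁ p) =
    let E′ , w , p′ , r = h E p in E′ , w , inj₁ p′ , r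
  shelling-lookup {P} (F ∷ L) (h , s) (suc k) E q =
    let E′ , w , q′ , r = shelling-lookup L s k E (to q) in E′ , w , from q′ , r
    where
    to : ∀ {E} → P E ⊎ (∃[ j ] (j Fin.< suc k × lookup (F ∷ L) j ≡ E)) →
         (P E ⊎ E ≡ F) ⊎ (∃[ j ] (j Fin.< k × lookup L j ≡ E))
    to (inj₁ p) = inj₁ (inj₁ p)
    to (inj₂ (zero , _ , e)) = inj₁ (inj₂ (≡-sym e))
    to (inj₂ (suc j , s≤s j<k , e)) = inj₂ (j , j<k , e)
    from : ∀ {E} → (P E ⊎ E ≡ F) ⊎ (∃[ j ] (j Fin.< k × lookup L j ≡ E)) →
           P E ⊎ (∃[ j ] (j Fin.< suc k × lookup (F ∷ L) j ≡ E))
    from (inj₁ (inj₁ p)) = inj₁ p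
    from (inj₁ (inj₂ e)) = inj₂ (zero , s≤s z≤n , ≡-sym e)
    from (inj₂ (j , j<k , e)) = inj₂ (suc j , s≤s j<k , e)

  shelling⇒shellable : ∀ {K : Complex m} L → (∀ {F} → F ∈ˡ L → IsFacet K F) →
                       (∀ {F} → IsFacet K F → F ∈ˡ L) → IsShelling (λ _ → ⊥) L → Shellable K
  shelling⇒shellable {K} L sound complete s =
    length L , lookup L , (λ i → sound (∈-lookup i)) ,
    (λ F f → Any.index (complete f) , ≡-sym (index-correct (complete f))) ,
    injective , pure
    where
    index-correct : ∀ {F L} (i : F ∈ˡ L) → F ≡ lookup L (Any.index i)
    index-correct (here e) = e
    index-correct (there i) = index-correct i
    -- A repeated facet would have to contain a vertex that it omits.
    distinct : ∀ {i j} → i Fin.< j → lookup L i ≢ lookup L j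
    distinct {i} {j} i<j e with shelling-lookup L s j (lookup L i) (inj₂ (i , i<j , refl))
    ... | _ , w , _ , w∈ , w∉ , _ = w∉ (subst (w ∈_) (≡-sym e) w∈)
    injective : ∀ {i j} → lookup L i ≡ lookup L j → i ≡ j
    injective {i} {j} e with Fin.<-cmp i j
    ... | tri< i<j _ _ = ⊥-elim (distinct i<j e)
    ... | tri≈ _ i≡j _ = i≡j
    ... | tri> _ _ j<i = ⊥-elim (distinct j<i (≡-sym e))
    pure : ∀ k → 0 ℕ.< Fin.toℕ k → PureOfSize (PrefixMeet (lookup L) k) (∣ lookup L k ∣ ∸ 1)
    pure k _ =
      (λ σ (σ⊆F , j , j<k , σ⊆E) →
        let _ , w , _ , w∈F , w∉E , _ = shelling-lookup L s k _ (inj₂ (j , j<k , refl)) in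
        subst (∣ σ ∣ ≤_) (size w∈F) (p⊆q⇒∣p∣≤∣q∣ (⊆- σ⊆F (w∉E ∘ σ⊆E)))) ,
      λ σ (σ⊆F , j , j<k , σ⊆E) → extend σ⊆F σ⊆E
        (shelling-lookup L s k _ (inj₂ (j , j<k , refl)))
      where
      size : ∀ {w} → w ∈ lookup L k → ∣ lookup L k - w ∣ ≡ ∣ lookup L k ∣ ∸ 1
      size w∈F = cong (_∸ 1) (suc∣p-x∣≡∣p∣ w∈F)
      extend : ∀ {σ E} → σ ⊆ lookup L k → σ ⊆ E →
        ShellStep (λ E → ⊥ ⊎ (∃[ j ] (j Fin.< k × lookup L j ≡ E))) (lookup L k) E →
        ∃[ τ ] (PrefixMeet (lookup L) k τ × σ ⊆ τ × ∣ τ ∣ ≡ ∣ lookup L k ∣ ∸ 1)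
      extend σ⊆F σ⊆E (_ , w , inj₂ (i , i<k , refl) , w∈F , w∉E , F-w⊆E′) =
        -- As `w ∉ E` and `σ ⊆ E`, the face `σ` survives the removal of `w`.
        lookup L k - w , (-⊆ _ w , i , i<k , F-w⊆E′) , ⊆- σ⊆F (w∉E ∘ σ⊆E) , size w∈F

-- Complexes all of whose minors have a simplicial vertex (Woodroofe's chordal clutters)

module Chordal {m : ℕ} (K : Complex m) (K? : Decidable K) (K-down : ∀ {A B} → A ⊆ B → K B → K A) where

  -- The minor with faces {A ∣ W ⊆ A ⊆ V} is encoded by W ⊆ V; the condition says that for
  -- minimal non-faces e₁ ≠ e₂ through v, the set (e₁ ∪ e₂) ∖ v is a non-face of the minor.
  Simplicial : Subset m → Subset m → Fin m → Set
  Simplicial W V v = ∀ X Y → W ⊆ X → W ⊆ Y → X ⊆ V → Y ⊆ V → v ∉ X → v ∉ Y →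
    K (X ∪ Y) → ¬ K (X ⊕ v) → ¬ K (Y ⊕ v) → ¬ K ((X ∩ Y) ⊕ v)

  simplicial? : ∀ W V → Decidable (Simplicial W V)
  simplicial? W V v = map′ to from (¬? (anySubset? λ X → anySubset? (violation? X)))
    where
    Violation : Subset m → Subset m → Set
    Violation X Y = W ⊆ X × W ⊆ Y × X ⊆ V × Y ⊆ V × v ∉ X × v ∉ Y ×
      K (X ∪ Y) × ¬ K (X ⊕ v) × ¬ K (Y ⊕ v) × K ((X ∩ Y) ⊕ v)
    violation? : ∀ X Y → Dec (Violation X Y)
    violation? X Y = (W ⊆? X) ×-dec (W ⊆? Y) ×-dec (X ⊆? V) ×-dec (Y ⊆? V) ×-dec ¬? (v ∈? X) ×-dec ¬? (v ∈? Y)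
      ×-dec K? (X ∪ Y) ×-dec ¬? (K? (X ⊕ v)) ×-dec ¬? (K? (Y ⊕ v)) ×-dec K? ((X ∩ Y) ⊕ v)
    to : ¬ (∃[ X ] ∃[ Y ] Violation X Y) → Simplicial W V v
    to h X Y a b c d e f g i j k = h (X , Y , a , b , c , d , e , f , g , i , j , k)
    from : Simplicial W V v → ¬ (∃[ X ] ∃[ Y ] Violation X Y)
    from h (X , Y , a , b , c , d , e , f , g , i , j , k) = h X Y a b c d e f g i j k

  Facet : Subset m → Subset m → Subset m → Set
  Facet W V F = W ⊆ F × F ⊆ V × K F × (∀ A → A ⊆ V → K A → F ⊆ A → A ⊆ F)

  extend-to-facet : ∀ k {W V A} → W ⊆ A → A ⊆ V → K A → ∣ V ∣ ≤ ∣ A ∣ + k → ∃[ F ] (Facet W V F × A ⊆ F)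
  extend-to-facet k {W} {V} {A} W⊆A A⊆V KA V≤ with Fin.any? (λ x → (x ∈? V) ×-dec ¬? (x ∈? A) ×-dec K? (A ⊕ x))
  ... | no ¬x = A , (W⊆A , A⊆V , KA , λ B B⊆V KB A⊆B {x} x∈B →
          decidable-stable (x ∈? A) λ x∉A → ¬x (x , B⊆V x∈B , x∉A , K-down (⊕-least A⊆B x∈B) KB)) , λ x∈ → x∈
  extend-to-facet zero {W} {V} {A} W⊆A A⊆V KA V≤ | yes (x , x∈V , x∉A , _) =
    contradiction (subst (∣ V ∣ ≤_) (+-identityʳ _) V≤) (<⇒≱ (p⊂q⇒∣p∣<∣q∣ (A⊆V , x , x∈V , x∉A)))
  extend-to-facet (suc k) {W} {V} {A} W⊆A A⊆V KA V≤ | yes (x , x∈V , x∉A , KAx)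
    with F , f , A⊆F ← extend-to-facet k {W} {V} {A ⊕ x} (λ y∈ → ⊆⊕ A x (W⊆A y∈)) (⊕-least A⊆V x∈V) KAx
           (≤-trans (subst (∣ V ∣ ≤_) (+-suc _ k) V≤) (+-monoˡ-≤ k (1+∣p∣≤∣p⊕x∣ x∉A))) =
    F , f , λ y∈ → A⊆F (⊆⊕ A x y∈)

  -- Says that `σ ⊕ v` is a minimal non-face of the minor. Since `K` is closed under subsets,
  -- deleting single vertices outside `W` suffices as a test.
  MinNonFace : Subset m → Subset m → Fin m → Subset m → Set
  MinNonFace W V v σ = W ⊆ σ × σ ⊆ V - v × K σ × ¬ K (σ ⊕ v) ×
                       (∀ s → s ∈ σ → s ∉ W → K ((σ - s) ⊕ v))

  minNonFace? : ∀ W V v → Decidable (MinNonFace W V v)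
  minNonFace? W V v σ = (W ⊆? σ) ×-dec (σ ⊆? V - v) ×-dec K? σ ×-dec ¬? (K? (σ ⊕ v)) ×-dec
    Fin.all? (λ s → (s ∈? σ) →-dec (¬? (s ∈? W) →-dec K? ((σ - s) ⊕ v)))

  find-minNonFace : ∀ k {W V v A} → W ⊆ A → A ⊆ V - v → K A → ¬ K (A ⊕ v) → ∣ A ∣ ≤ k →
                    ∃[ σ ] (MinNonFace W V v σ × σ ⊆ A)
  find-minNonFace k {W} {V} {v} {A} W⊆A A⊆V KA ¬KAv A≤k
    with Fin.any? (λ s → (s ∈? A) ×-dec ¬? (s ∈? W) ×-dec ¬? (K? ((A - s) ⊕ v)))
  ... | no ¬s = A , (W⊆A , A⊆V , KA , ¬KAv , λ s s∈A s∉W →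
          decidable-stable (K? _) λ ¬K → ¬s (s , s∈A , s∉W , ¬K)) , λ x∈ → x∈
  find-minNonFace zero {A = A} _ _ _ _ A≤0 | yes (s , s∈A , _) =
    contradiction (≤-trans (x∈p⇒∣p-x∣<∣p∣ s∈A) A≤0) λ ()
  find-minNonFace (suc k) {W} {V} {v} {A} W⊆A A⊆V KA ¬KAv A≤k | yes (s , s∈A , s∉W , ¬K)
    with σ , h , σ⊆ ← find-minNonFace k {W} {V} {v} {A - s} (⊆- W⊆A s∉W) (λ x∈ → A⊆V (-⊆ A s x∈))
           (K-down (-⊆ A s) KA) ¬K (ℕ.s≤s⁻¹ (≤-trans (x∈p⇒∣p-x∣<∣p∣ s∈A) A≤k)) =
    σ , h , λ x∈ → -⊆ A s (σ⊆ x∈)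

  -- Shellings of minors

  record Shelling (W V : Subset m) : Set where
    field
      facets   : List (Subset m)
      sound    : ∀ {F} → F ∈ˡ facets → Facet W V F
      complete : ∀ {F} → Facet W V F → F ∈ˡ facets
      shelling : IsShelling (λ _ → ⊥) facets

  -- A shelling lists first the facets through v and then, for each minimal σ with σ ∪ v ∉ K,
  -- the facets that contain σ. Simpliciality of v makes σ unique for a given facet F, and for
  -- w ∈ σ it makes (F ∖ w) ∪ v a face, so F ∖ w lies in a facet of the first group.
  module _ {W V v} (W⊆V : W ⊆ V) (v∈V : v ∈ V) (v∉W : v ∉ W) (simp : Simplicial W V v)
           (star : Shelling (W ⊕ v) V)
           (rest : ∀ σ → MinNonFace W V v σ → Shelling σ (V - v)) where

    open Shelling

    -- A vertex `s ∈ σ` outside `τ` would put `σ ∩ τ` inside `σ - s`, so `(σ ∩ τ) ⊕ v` would be a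
    -- face by minimality and a non-face by simpliciality.
    unique-minNonFace : ∀ {σ τ A} → MinNonFace W V v σ → MinNonFace W V v τ → K A → σ ⊆ A → τ ⊆ A → σ ⊆ τ
    unique-minNonFace {σ} {τ} (W⊆σ , σ⊆V , _ , ¬Kσ , min) (W⊆τ , τ⊆V , _ , ¬Kτ , _) KA σ⊆A τ⊆A {s} s∈σ =
      decidable-stable (s ∈? τ) λ s∉τ →
        simp σ τ W⊆σ W⊆τ (λ x∈ → -⊆ V v (σ⊆V x∈)) (λ x∈ → -⊆ V v (τ⊆V x∈))
          (λ v∈ → ∉- V v (σ⊆V v∈)) (λ v∈ → ∉- V v (τ⊆V v∈)) (K-down (∪-least σ⊆A τ⊆A) KA) ¬Kσ ¬Kτ
          (K-down (⊕-mono v (⊆- (p∩q⊆p σ τ) (λ s∈ → s∉τ (p∩q⊆q σ τ s∈)))) (min s s∈σ (λ s∈W → s∉τ (W⊆τ s∈W))))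

    cross-step : ∀ {σ F E} → MinNonFace W V v σ → Facet σ (V - v) F → W ⊆ E → ¬ (σ ⊆ E) →
                 ShellStep (_∈ˡ facets star) F E
    cross-step {σ} {F} {E} (W⊆σ , σ⊆V , _ , ¬Kσ , min) (σ⊆F , F⊆V , KF , _) W⊆E σ⊈E
      with Fin.any? (λ w → (w ∈? σ) ×-dec ¬? (w ∈? E))
    ... | no ¬w = ⊥-elim (σ⊈E λ {w} w∈σ → decidable-stable (w ∈? E) λ w∉E → ¬w (w , w∈σ , w∉E))
    ... | yes (w , w∈σ , w∉E) =
      let E′ , f , ⊆E′ = extend-to-facet ∣ V ∣ {W ⊕ v} {V} (⊕-mono v W⊆F-w) (⊕-least F-w⊆V v∈V) KF-wv (m≤n+m _ _)
      in E′ , w , complete star f , σ⊆F w∈σ , w∉E , λ x∈ → ⊆E′ (⊆⊕ (F - w) v x∈)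
      where
      W⊆F-w : W ⊆ F - w
      W⊆F-w = ⊆- (λ x∈ → σ⊆F (W⊆σ x∈)) (λ w∈W → w∉E (W⊆E w∈W))
      F-w⊆V : F - w ⊆ V
      F-w⊆V x∈ = -⊆ V v (F⊆V (-⊆ F w x∈))
      KF-wv : K ((F - w) ⊕ v)
      -- Simpliciality is applied to `σ` and `F - w`. Their intersection omits `w`, so with `v`
      -- added it is a face by minimality of `σ`.
      KF-wv = decidable-stable (K? _) λ ¬K →
        simp σ (F - w) W⊆σ W⊆F-w (λ x∈ → -⊆ V v (σ⊆V x∈)) F-w⊆V
          (λ v∈ → ∉- V v (σ⊆V v∈)) (λ v∈ → ∉- V v (F⊆V (-⊆ F w v∈)))
          (K-down (∪-least σ⊆F (-⊆ F w)) KF) ¬Kσ ¬K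
          (K-down (⊕-mono v (⊆- (p∩q⊆p σ (F - w)) (λ w∈ → ∉- F w (p∩q⊆q σ (F - w) w∈))))
            (min w w∈σ (λ w∈W → w∉E (W⊆E w∈W))))

    block : ∀ σ → Dec (MinNonFace W V v σ) → List (Subset m)
    block σ (yes h) = facets (rest σ h)
    block σ (no _) = []

    block-sound : ∀ σ d {F} → F ∈ˡ block σ d → MinNonFace W V v σ × Facet σ (V - v) F
    block-sound σ (yes h) i = h , sound (rest σ h) i

    block-shelling : ∀ σ d → IsShelling (λ _ → ⊥) (block σ d)
    block-shelling σ (yes h) = shelling (rest σ h)
    block-shelling σ (no _) = tt

    block-complete : ∀ {σ F} d → MinNonFace W V v σ → Facet σ (V - v) F → F ∈ˡ block σ d
    block-complete (yes h) _ f = complete (rest _ h) f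
    block-complete (no ¬h) h _ = ⊥-elim (¬h h)

    blocks : List (Subset m) → List (Subset m)
    blocks [] = []
    blocks (σ ∷ σs) = block σ (minNonFace? W V v σ) ++ blocks σs

    blocks-sound : ∀ σs {F} → F ∈ˡ blocks σs → ∃[ σ ] (MinNonFace W V v σ × Facet σ (V - v) F)
    blocks-sound (σ ∷ σs) i with ∈-++⁻ (block σ (minNonFace? W V v σ)) i
    ... | inj₁ j = σ , block-sound σ (minNonFace? W V v σ) j
    ... | inj₂ j = blocks-sound σs j

    blocks-complete : ∀ {σs σ F} → σ ∈ˡ σs → MinNonFace W V v σ → Facet σ (V - v) F → F ∈ˡ blocks σs
    blocks-complete {σ = σ} (here refl) h f = ∈-++⁺ˡ (block-complete (minNonFace? W V v σ) h f)
    blocks-complete {σs = τ ∷ _} (there i) h f = ∈-++⁺ʳ (block τ (minNonFace? W V v τ)) (blocks-complete i h f)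

    -- `apart` says that no facet listed so far contains a `σ` still to come, as `cross-step`
    -- requires. Facets through `v` satisfy it because `σ ⊕ v` is a non-face; a finished block
    -- preserves it by `unique-minNonFace`.
    blocks-shelling : ∀ {P} σs → Unique σs → (∀ {E} → E ∈ˡ facets star → P E) → (∀ {E} → P E → W ⊆ E) →
      (∀ {σ} → σ ∈ˡ σs → MinNonFace W V v σ → ∀ E → P E → ¬ (σ ⊆ E)) → IsShelling P (blocks σs)
    blocks-shelling [] _ _ _ _ = tt
    blocks-shelling {P} (σ ∷ σs) (σ∉σs ∷ u) star⊆P W⊆ apart =
      shelling-++ B (blocks σs)
        (shelling-resp B [ id , (λ ()) ]′ inj₁ (shelling-prior B prior (block-shelling σ (minNonFace? W V v σ))))
        (blocks-shelling σs u (inj₁ ∘ star⊆P) W⊆′ apart′)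
      where
      B = block σ (minNonFace? W V v σ)
      prior : ∀ F → F ∈ˡ B → ∀ E → P E → ShellStep P F E
      prior F i E p =
        let h , f = block-sound σ (minNonFace? W V v σ) i
            E′ , w , e , r = cross-step h f (W⊆ p) (apart (here refl) h E p)
        in E′ , w , star⊆P e , r
      W⊆′ : ∀ {E} → P E ⊎ E ∈ˡ B → W ⊆ E
      W⊆′ (inj₁ p) = W⊆ p
      W⊆′ (inj₂ i) x∈W with (W⊆σ , _) , (σ⊆F , _) ← block-sound σ (minNonFace? W V v σ) i = σ⊆F (W⊆σ x∈W)
      apart′ : ∀ {τ} → τ ∈ˡ σs → MinNonFace W V v τ → ∀ E → P E ⊎ E ∈ˡ B → ¬ (τ ⊆ E)
      apart′ τ∈ h E (inj₁ p) = apart (there τ∈) h E p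
      apart′ τ∈ h E (inj₂ i) τ⊆E with h′ , (σ⊆E , _ , KE , _) ← block-sound σ (minNonFace? W V v σ) i =
        All-lookup σ∉σs τ∈ (⊆-antisym (unique-minNonFace h′ h KE σ⊆E τ⊆E) (unique-minNonFace h h′ KE τ⊆E σ⊆E))

    combine : Shelling W V
    combine .facets = facets star ++ blocks (allSubsets m)
    combine .sound i with ∈-++⁻ (facets star) i
    ... | inj₁ j with W⊆F , F⊆V , KF , max ← sound star j =
      (λ x∈ → W⊆F (⊆⊕ W v x∈)) , F⊆V , KF , max
    ... | inj₂ j with σ , (W⊆σ , _ , _ , ¬Kσ , _) , (σ⊆F , F⊆V , KF , max) ← blocks-sound (allSubsets m) j =
      (λ x∈ → σ⊆F (W⊆σ x∈)) , (λ x∈ → -⊆ V v (F⊆V x∈)) , KF ,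
      -- A face above `F` contains `σ` and hence not `v`, so maximality within `V - v` is maximality
      -- within `V`.
      λ A A⊆V KA F⊆A → max A (⊆- A⊆V λ v∈A → ¬Kσ (K-down (⊕-least (λ x∈ → F⊆A (σ⊆F x∈)) v∈A) KA)) KA F⊆A
    combine .complete {F} (W⊆F , F⊆V , KF , max) with v ∈? F
    ... | yes v∈F = ∈-++⁺ˡ (complete star (⊕-least W⊆F v∈F , F⊆V , KF , max))
    -- Maximality of `F` makes `F ⊕ v` a non-face, so `F` contains a minimal `σ`.
    ... | no v∉F with σ , h , σ⊆F ← find-minNonFace ∣ F ∣ {W} {V} {v} W⊆F (⊆- F⊆V v∉F) KF
                       (λ K′ → v∉F (max (F ⊕ v) (⊕-least F⊆V v∈V) K′ (⊆⊕ F v) (∈⊕ F v))) ≤-refl =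
      ∈-++⁺ʳ (facets star) (blocks-complete (∈-allSubsets σ) h
        (σ⊆F , ⊆- F⊆V v∉F , KF , λ A A⊆V → max A (λ x∈ → -⊆ V v (A⊆V x∈))))
    combine .shelling = shelling-++ (facets star) (blocks (allSubsets m)) (shelling star)
      (blocks-shelling (allSubsets m) (allSubsets-unique m) inj₂
        (λ { (inj₁ ()) ; (inj₂ i) x∈ → proj₁ (sound star i) (⊆⊕ W v x∈) })
        λ { _ _ _ (inj₁ ()) ; _ (_ , _ , _ , ¬Kσ , _) E (inj₂ i) σ⊆E →
            let W⊆E , _ , KE , _ = sound star i in ¬Kσ (K-down (⊕-least σ⊆E (W⊆E (∈⊕ W v))) KE) })

  module _ (simplicial : ∀ {W V} → W ⊆ V → K W → ∀ {u} → u ∈ V → u ∉ W →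
                         ¬ (∀ v → v ∈ V → v ∉ W → ¬ Simplicial W V v)) where

    -- Induction on a bound `k` for the number of vertices of `V` outside `W`: the star enlarges
    -- `W`, the other minors shrink `V`.
    minor-shelling : ∀ k {W V} → W ⊆ V → K W → ∣ V ∣ ≤ ∣ W ∣ + k → Shelling W V
    minor-shelling k {W} {V} W⊆V KW V≤
      with Fin.any? (λ v → (v ∈? V) ×-dec ¬? (v ∈? W) ×-dec simplicial? W V v)
    ... | no ¬v = record
      { facets = W ∷ []
      ; sound = λ { (here refl) → (λ x∈ → x∈) , W⊆V , KW , λ A A⊆V _ _ x∈ → V⊆W (A⊆V x∈) }
      ; complete = λ (W⊆F , F⊆V , _) → here (⊆-antisym (λ x∈ → V⊆W (F⊆V x∈)) W⊆F)
      ; shelling = (λ _ ()) , tt }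
      where
      V⊆W : V ⊆ W
      V⊆W {u} u∈V = decidable-stable (u ∈? W) λ u∉W →
        simplicial W⊆V KW u∈V u∉W λ v v∈V v∉W s → ¬v (v , v∈V , v∉W , s)
    minor-shelling zero {W} {V} W⊆V KW V≤ | yes (v , v∈V , v∉W , _) =
      contradiction (subst (∣ V ∣ ≤_) (+-identityʳ _) V≤) (<⇒≱ (p⊂q⇒∣p∣<∣q∣ (W⊆V , v , v∈V , v∉W)))
    minor-shelling (suc k) {W} {V} W⊆V KW V≤ | yes (v , v∈V , v∉W , simp) with K? (W ⊕ v)
    ... | yes KWv = combine W⊆V v∈V v∉W simp
      (minor-shelling k (⊕-least W⊆V v∈V) KWv
        (≤-trans (subst (∣ V ∣ ≤_) (+-suc _ k) V≤) (+-monoˡ-≤ k (1+∣p∣≤∣p⊕x∣ v∉W))))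
      λ σ (W⊆σ , σ⊆V , Kσ , _) → minor-shelling k σ⊆V Kσ
        (ℕ.s≤s⁻¹ (≤-trans (x∈p⇒∣p-x∣<∣p∣ v∈V) (≤-trans (subst (∣ V ∣ ≤_) (+-suc _ k) V≤)
          (s≤s (+-monoˡ-≤ k (p⊆q⇒∣p∣≤∣q∣ W⊆σ))))))
    -- No face of the minor contains `v`, so deleting `v` leaves the facets unchanged.
    ... | no ¬KWv = record
      { facets = facets
      ; sound = λ i → let W⊆F , F⊆V , KF , max = sound i in
          W⊆F , (λ x∈ → -⊆ V v (F⊆V x∈)) , KF ,
          λ A A⊆V KA F⊆A → max A (⊆- A⊆V (v∉ KA (λ x∈ → F⊆A (W⊆F x∈)))) KA F⊆A
      ; complete = λ (W⊆F , F⊆V , KF , max) → complete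
          (W⊆F , ⊆- F⊆V (v∉ KF W⊆F) , KF , λ A A⊆V → max A (λ x∈ → -⊆ V v (A⊆V x∈)))
      ; shelling = shelling }
      where
      v∉ : ∀ {A} → K A → W ⊆ A → v ∉ A
      v∉ KA W⊆A v∈A = ¬KWv (K-down (⊕-least W⊆A v∈A) KA)
      open Shelling (minor-shelling k {W} {V - v} (⊆- W⊆V v∉W) KW
        (ℕ.s≤s⁻¹ (≤-trans (x∈p⇒∣p-x∣<∣p∣ v∈V) (subst (∣ V ∣ ≤_) (+-suc _ k) V≤))))

    chordal⇒shellable : K ∅ → Shellable K
    chordal⇒shellable K∅ = shelling⇒shellable facets
      (λ i → let _ , _ , KF , max = sound i in KF , λ A → max A ⊆⊤)
      (λ (KF , max) → complete (⊥⊆ , ⊆⊤ , KF , λ A _ → max A)) shelling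
      where open Shelling (minor-shelling m {∅} {full} ⊥⊆ K∅ (≤-trans (∣p∣≤n full) (m≤n+m m _)))

-- Reachability and independence

module Independence (G : Graph) where

  V : Set
  V = Fin (n G)

  infix 4 _~_ _~?_

  _~_ : V → V → Set
  _~_ = Edge G

  _~?_ : ∀ u v → Dec (u ~ v)
  u ~? v = T? (adj G u v)

  ~-sym : ∀ {u v} → u ~ v → v ~ u
  ~-sym {u} {v} = subst T (Graph.sym G u v)

  ~⇒≢ : ∀ {u v} → u ~ v → u ≢ v
  ~⇒≢ {u} e refl = subst T (irrefl G u) e

  reach-source : ∀ {S u v} → Reach G S u v → u ∈ S
  reach-source (here u∈S) = u∈S
  reach-source (step r _ _) = reach-source r

  reach-target : ∀ {S u v} → Reach G S u v → v ∈ S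
  reach-target (here u∈S) = u∈S
  reach-target (step _ _ v∈S) = v∈S

  reach-mono : ∀ {S S′ u v} → S ⊆ S′ → Reach G S u v → Reach G S′ u v
  reach-mono S⊆ (here u∈S) = here (S⊆ u∈S)
  reach-mono S⊆ (step r e v∈S) = step (reach-mono S⊆ r) e (S⊆ v∈S)

  reach-trans : ∀ {S u v w} → Reach G S u v → Reach G S v w → Reach G S u w
  reach-trans r (here _) = r
  reach-trans r (step s e w∈S) = step (reach-trans r s) e w∈S

  reach-edge : ∀ {S u v} → u ∈ S → u ~ v → v ∈ S → Reach G S u v
  reach-edge u∈S e v∈S = step (here u∈S) e v∈S

  reach-sym : ∀ {S u v} → Reach G S u v → Reach G S v u
  reach-sym (here u∈S) = here u∈S
  reach-sym (step r e v∈S) = reach-trans (reach-edge v∈S (~-sym e) (reach-target r)) (reach-sym r)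

  Closed : Subset (n G) → Subset (n G) → Set
  Closed A C = ∀ {c y} → c ∈ C → y ∈ A → c ~ y → y ∈ C

  Escape : Subset (n G) → Subset (n G) → Set
  Escape A C = ∃[ c ] ∃[ y ] (c ∈ C × y ∈ A × y ∉ C × c ~ y)

  closed-or-escape : ∀ A C → Closed A C ⊎ Escape A C
  closed-or-escape A C
    with Fin.any? (λ c → Fin.any? λ y → (c ∈? C) ×-dec (y ∈? A) ×-dec ¬? (y ∈? C) ×-dec (c ~? y))
  ... | yes e = inj₂ e
  ... | no ¬e = inj₁ λ {c} {y} c∈C y∈A e → decidable-stable (y ∈? C) λ y∉C → ¬e (c , y , c∈C , y∈A , y∉C , e)

  closed-reach : ∀ {A C u v} → Closed A C → u ∈ C → Reach G A u v → v ∈ C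
  closed-reach cl u∈C (here _) = u∈C
  closed-reach cl u∈C (step r e v∈A) = cl (closed-reach cl u∈C r) v∈A e

  -- Search from `v`: the set `C` gains one reachable vertex per round until it is closed, and `k`
  -- counts the vertices missing to `r + 1`.
  small-or-big : ∀ k r {A v C} → ∣ C ∣ + k ≡ suc r → v ∈ C → (∀ u → u ∈ C → Reach G A v u) →
    (∃[ D ] (v ∈ D × ∣ D ∣ ≤ r × Closed A D)) ⊎ (∃[ D ] (r ℕ.< ∣ D ∣ × (∀ u → u ∈ D → Reach G A v u)))
  small-or-big zero r {C = C} eq v∈C reach = inj₂ (C , ≤-reflexive (trans (≡-sym eq) (+-identityʳ _)) , reach)
  small-or-big (suc k) r {A} {v} {C} eq v∈C reach with closed-or-escape A C
  ... | inj₁ cl = inj₁ (C , v∈C , m+n≤o⇒m≤o ∣ C ∣ (ℕ.s≤s⁻¹ (≤-reflexive (trans (≡-sym (+-suc _ k)) eq))) , cl)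
  ... | inj₂ (c , y , c∈C , y∈A , y∉C , e) =
    small-or-big k r (trans (cong (_+ k) (≤-antisym (∣p⊕x∣≤1+∣p∣ C y) (1+∣p∣≤∣p⊕x∣ y∉C))) (trans (≡-sym (+-suc _ k)) eq))
      (⊆⊕ C y v∈C) reach′
    where
    reach′ : ∀ u → u ∈ C ⊕ y → Reach G A v u
    reach′ u u∈ with ∈⊕⁻ C y u∈
    ... | inj₁ u∈C = reach u u∈C
    ... | inj₂ refl = step (reach c c∈C) e y∈A

  independent? : ∀ r → Decidable (Ind G r)
  independent? r A = Fin.all? λ v → small? v
    where
    small? : ∀ v → Dec (v ∈ A → ∀ C → (∀ u → u ∈ C → Reach G A v u) → ∣ C ∣ ≤ r)
    small? v with v ∈? A
    ... | no v∉A = yes λ v∈A → ⊥-elim (v∉A v∈A)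
    ... | yes v∈A with small-or-big r r {A} {v} {⁅ v ⁆} (cong (_+ r) (∣⁅x⁆∣≡1 v)) (x∈⁅x⁆ v)
                         (λ u u∈ → subst (Reach G A v) (≡-sym (x∈⁅y⁆⇒x≡y v u∈)) (here v∈A))
    ...   | inj₁ (D , v∈D , D≤ , cl) = yes λ _ C reach →
              ≤-trans (p⊆q⇒∣p∣≤∣q∣ (λ {u} u∈C → closed-reach cl v∈D (reach u u∈C))) D≤
    ...   | inj₂ (D , D> , reach) = no λ h → contradiction (h v∈A D reach) (<⇒≱ D>)

  independent-⊆ : ∀ r {A B} → A ⊆ B → Ind G r B → Ind G r A
  independent-⊆ r A⊆B h v v∈A C reach = h v (A⊆B v∈A) C λ u u∈C → reach-mono A⊆B (reach u u∈C)

  independent-∅ : ∀ r → Ind G r ∅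
  independent-∅ r v v∈∅ = ⊥-elim (∉⊥ v∈∅)

  -- If no vertex of `X` outside `C` were adjacent to `C`, a component of `X ⊕ v` would either stay
  -- in `C`, which has at most `r` vertices, or avoid `v` and be connected already in `X`.
  grow : ∀ r {X v C} → Ind G r X → ¬ Ind G r (X ⊕ v) → v ∈ C → ∣ C ∣ ≤ r → Escape X C
  grow r {X} {v} {C} indX ¬ind v∈C C≤ with closed-or-escape (X ⊕ v) C
  ... | inj₂ (c , y , c∈C , y∈ , y∉C , e) with ∈⊕⁻ X v y∈
  ...   | inj₁ y∈X = c , y , c∈C , y∈X , y∉C , e
  ...   | inj₂ refl = ⊥-elim (y∉C v∈C)
  grow r {X} {v} {C} indX ¬ind v∈C C≤ | inj₁ cl = ⊥-elim (¬ind ind)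
    where
    outside-C : ∀ {u w} → u ∉ C → Reach G (X ⊕ v) u w → Reach G X u w × w ∉ C
    outside-C u∉C (here u∈) with ∈⊕⁻ X v u∈
    ... | inj₁ u∈X = here u∈X , u∉C
    ... | inj₂ refl = ⊥-elim (u∉C v∈C)
    outside-C u∉C (step r e y∈) with outside-C u∉C r | ∈⊕⁻ X v y∈
    ... | _ , w∉C | inj₂ refl = ⊥-elim (w∉C (cl v∈C (reach-target r) (~-sym e)))
    ... | r′ , w∉C | inj₁ y∈X = step r′ e y∈X , λ y∈C → w∉C (cl y∈C (reach-target r) (~-sym e))
    ind : Ind G r (X ⊕ v)
    ind u u∈ D reach with u ∈? C
    ... | yes u∈C = ≤-trans (p⊆q⇒∣p∣≤∣q∣ (λ {w} w∈D → closed-reach cl u∈C (reach w w∈D))) C≤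
    ... | no u∉C = indX u (reach-source (proj₁ (outside-C u∉C (here u∈)))) D λ w w∈D → proj₁ (outside-C u∉C (reach w w∈D))

  -- The disjunctions attach each vertex to an earlier one, which expresses connectedness of the
  -- four. Most contradictions below end here.
  no-connected-4-set : ∀ {M a b c d} → Ind G 3 M → a ∈ M → b ∈ M → c ∈ M → d ∈ M →
    a ~ b → a ~ c ⊎ b ~ c → a ~ d ⊎ b ~ d ⊎ c ~ d → a ≢ c → b ≢ c → a ≢ d → b ≢ d → c ≢ d → ⊥
  no-connected-4-set {M} {a} {b} {c} {d} ind a∈ b∈ c∈ d∈ ab abc abcd a≢c b≢c a≢d b≢d c≢d =
    contradiction (ind a a∈ D reach) (<⇒≱ 4≤D)
    where
    A = ⁅ a ⁆
    B = A ⊕ b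
    C = B ⊕ c
    D = C ⊕ d
    in-B : ∀ {x} → x ∈ B → x ≡ a ⊎ x ≡ b
    in-B x∈ with ∈⊕⁻ A b x∈
    ... | inj₁ x∈A = inj₁ (x∈⁅y⁆⇒x≡y a x∈A)
    ... | inj₂ e = inj₂ e
    in-C : ∀ {x} → x ∈ C → x ≡ a ⊎ x ≡ b ⊎ x ≡ c
    in-C x∈ with ∈⊕⁻ B c x∈
    ... | inj₂ e = inj₂ (inj₂ e)
    ... | inj₁ x∈B with in-B x∈B
    ...   | inj₁ e = inj₁ e
    ...   | inj₂ e = inj₂ (inj₁ e)
    4≤D : 4 ≤ ∣ D ∣
    4≤D = ≤-trans (s≤s (≤-trans (s≤s (≤-trans (s≤s (≤-reflexive (≡-sym (∣⁅x⁆∣≡1 a))))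
        (1+∣p∣≤∣p⊕x∣ λ b∈A → ~⇒≢ ab (≡-sym (x∈⁅y⁆⇒x≡y a b∈A)))))
        (1+∣p∣≤∣p⊕x∣ λ c∈B → [ a≢c ∘ ≡-sym , b≢c ∘ ≡-sym ]′ (in-B c∈B))))
        (1+∣p∣≤∣p⊕x∣ λ d∈C → [ a≢d ∘ ≡-sym , [ b≢d ∘ ≡-sym , c≢d ∘ ≡-sym ]′ ]′ (in-C d∈C))
    rb : Reach G M a b
    rb = reach-edge a∈ ab b∈
    rc : Reach G M a c
    rc = [ (λ e → reach-edge a∈ e c∈) , (λ e → step rb e c∈) ]′ abc
    rd : Reach G M a d
    rd = [ (λ e → reach-edge a∈ e d∈) , [ (λ e → step rb e d∈) , (λ e → step rc e d∈) ]′ ]′ abcd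
    reach : ∀ u → u ∈ D → Reach G M a u
    reach u u∈ with ∈⊕⁻ C d u∈
    ... | inj₂ refl = rd
    ... | inj₁ u∈C with in-C u∈C
    ...   | inj₁ refl = here a∈
    ...   | inj₂ (inj₁ refl) = rb
    ...   | inj₂ (inj₂ refl) = rc

-- Separation in block graphs

module Separation (G : Graph) (block : IsBlockGraph G) where

  open Independence G public

  -- If `B` is not a block, a strictly larger set of the same kind contains it, and being a clique
  -- passes down to `B`; `k` bounds the number of vertices outside `B`. Adjacency is decidable, so
  -- the case distinction may be made under a double negation.
  twoConn⇒clique : ∀ k B → n G ≤ ∣ B ∣ + k → TwoConn G B → IsClique G B
  twoConn⇒clique k B n≤ tc u v u∈B v∈B u≢v = decidable-stable (u ~? v) λ ¬e →
    ¬e (block B (tc , λ B′ B⊆B′ tc′ {w} w∈B′ → decidable-stable (w ∈? B) λ w∉B →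
      ¬e (larger k n≤ B′ B⊆B′ tc′ w∈B′ w∉B)) u v u∈B v∈B u≢v)
    where
    larger : ∀ k → n G ≤ ∣ B ∣ + k → ∀ B′ → B ⊆ B′ → TwoConn G B′ → ∀ {w} → w ∈ B′ → w ∉ B → u ~ v
    larger zero n≤ B′ B⊆B′ _ w∈B′ w∉B = contradiction
      (≤-trans (∣p∣≤n B′) (subst (n G ≤_) (+-identityʳ _) n≤)) (<⇒≱ (p⊂q⇒∣p∣<∣q∣ (B⊆B′ , _ , w∈B′ , w∉B)))
    larger (suc k) n≤ B′ B⊆B′ tc′ w∈B′ w∉B = twoConn⇒clique k B′
      (≤-trans (subst (n G ≤_) (+-suc _ k) n≤) (+-monoˡ-≤ k (p⊂q⇒∣p∣<∣q∣ (B⊆B′ , _ , w∈B′ , w∉B))))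
      tc′ u v (B⊆B′ u∈B) (B⊆B′ v∈B) u≢v

  Near : V → V → Set
  Near u v = u ≡ v ⊎ u ~ v

  near? : ∀ u v → Dec (Near u v)
  near? u v = (u Fin.≟ v) ⊎-dec (u ~? v)

  -- Cuts a walk at its first visit to `y`; the part before that visit avoids `y`.
  first-hit : ∀ {S a b} y → Reach G S a b →
    Reach G (S - y) a b ⊎ (a ≡ y ⊎ ∃[ z ] (Reach G (S - y) a z × z ~ y × y ∈ S))
  first-hit {a = a} y (here a∈S) with a Fin.≟ y
  ... | yes a≡y = inj₂ (inj₁ a≡y)
  ... | no a≢y = inj₁ (here (x∈p∧x≢y⇒x∈p-y a∈S a≢y))
  first-hit y (step {v = v} r e v∈S) with first-hit y r
  ... | inj₂ h = inj₂ h
  ... | inj₁ r′ with v Fin.≟ y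
  ...   | yes refl = inj₂ (inj₂ (_ , r′ , e , v∈S))
  ...   | no v≢y = inj₁ (step r′ e (x∈p∧x≢y⇒x∈p-y v∈S v≢y))

  hit : ∀ {S a b} y → Reach G S a b → Reach G (S - y) a b ⊎ Reach G S a y
  hit {S} y r with first-hit y r
  ... | inj₁ r′ = inj₁ r′
  ... | inj₂ (inj₁ refl) = inj₂ (here (reach-source r))
  ... | inj₂ (inj₂ (z , r′ , e , y∈S)) = inj₂ (step (reach-mono (-⊆ S y) r′) e y∈S)

  -- Every vertex of a minimal connection S between two neighbours a, b of v ∉ S is essential,
  -- so S ∪ v is a cycle and hence a clique.
  module _ {v a b S} (v∉S : v ∉ S) (va : v ~ a) (vb : v ~ b) (r : Reach G S a b)
           (essential : ∀ y → y ∈ S → ¬ Reach G (S - y) a b) where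

    private
      C : Subset (n G)
      C = S ⊕ v

    reach-around : ∀ {x y} → y ∈ S → y ≢ x → ∀ {c d} → Reach G S c d → ¬ Reach G (S - y) c d →
                   Reach G (S - x) c y ⊎ c ≡ y ⊎ Reach G (S - y) c x
    reach-around {x} {y} y∈S y≢x rcd ¬r with first-hit y rcd
    ... | inj₁ r′ = ⊥-elim (¬r r′)
    ... | inj₂ (inj₁ e) = inj₂ (inj₁ e)
    ... | inj₂ (inj₂ (z , r′ , e , _)) with hit x r′
    ...   | inj₂ rx = inj₂ (inj₂ rx)
    ...   | inj₁ r″ = inj₁ (step (reach-mono S-y-x⊆ r″) e (x∈p∧x≢y⇒x∈p-y y∈S y≢x))
      where
      S-y-x⊆ : S - y - x ⊆ S - x
      S-y-x⊆ w∈ = x∈p∧x≢y⇒x∈p-y (-⊆ S y (-⊆ (S - y) x w∈)) (∈-≢ (S - y) x w∈)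

    from-v : ∀ {c y x} → v ~ c → x ∈ S → Reach G (S - x) c y → Reach G (C - x) v y
    from-v vc x∈S r = reach-trans (reach-edge v∈ vc (S-x⊆ (reach-source r))) (reach-mono S-x⊆ r)
      where
      S-x⊆ : ∀ {x} → S - x ⊆ C - x
      S-x⊆ {x} w∈ = x∈p∧x≢y⇒x∈p-y (⊆⊕ S v (-⊆ S x w∈)) (∈-≢ S x w∈)
      v∈ : v ∈ C - _
      v∈ = x∈p∧x≢y⇒x∈p-y (∈⊕ S v) λ { refl → v∉S x∈S }

    from-v′ : ∀ {c x} → v ~ c → x ∈ S → c ∈ S → c ≢ x → Reach G (C - x) v c
    from-v′ {c} {x} vc x∈S c∈S c≢x = from-v vc x∈S (here (x∈p∧x≢y⇒x∈p-y c∈S c≢x))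

    -- One of `a`, `b` reaches `y` without `x`. Otherwise both meet `x` before `y`, and joining
    -- these walks at `x` connects `a` to `b` without the essential vertex `y`.
    around : ∀ {x y} → x ∈ S → y ∈ S → y ≢ x → Reach G (C - x) v y
    around {x} {y} x∈S y∈S y≢x
      with reach-around y∈S y≢x r (essential y y∈S)
         | reach-around y∈S y≢x (reach-sym r) (λ r′ → essential y y∈S (reach-sym r′))
    ... | inj₁ ra | _ = from-v va x∈S ra
    ... | inj₂ (inj₁ refl) | _ = from-v′ va x∈S y∈S y≢x
    ... | inj₂ (inj₂ _) | inj₁ rb = from-v vb x∈S rb
    ... | inj₂ (inj₂ _) | inj₂ (inj₁ refl) = from-v′ vb x∈S y∈S y≢x
    ... | inj₂ (inj₂ ra) | inj₂ (inj₂ rb) = ⊥-elim (essential y y∈S (reach-trans ra (reach-sym rb)))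

    reach-S : ∀ y → y ∈ S → Reach G S a y
    reach-S y y∈S with hit y r
    ... | inj₁ r′ = ⊥-elim (essential y y∈S r′)
    ... | inj₂ r′ = r′

    connected-from : ∀ {B} u → (∀ w → w ∈ B → Reach G B u w) → Connected G B
    connected-from u reach x y x∈ y∈ = reach-trans (reach-sym (reach x x∈)) (reach y y∈)

    cycle-twoConn : TwoConn G C
    cycle-twoConn = connected-from v reach-C , minus
      where
      reach-C : ∀ w → w ∈ C → Reach G C v w
      reach-C w w∈ with ∈⊕⁻ S v w∈
      ... | inj₁ w∈S = reach-trans (reach-edge (∈⊕ S v) va (⊆⊕ S v (reach-source r))) (reach-mono (⊆⊕ S v) (reach-S w w∈S))
      ... | inj₂ refl = here (∈⊕ S v)
      minus : ∀ x → x ∈ C → Connected G (C - x)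
      minus x x∈ with ∈⊕⁻ S v x∈
      ... | inj₂ refl = connected-from a reach-C-v
        where
        reach-C-v : ∀ w → w ∈ C - v → Reach G (C - v) a w
        reach-C-v w w∈ with ∈⊕⁻ S v (-⊆ C v w∈)
        ... | inj₁ w∈S = reach-mono (⊆- (⊆⊕ S v) v∉S) (reach-S w w∈S)
        ... | inj₂ refl = ⊥-elim (∉- C v w∈)
      ... | inj₁ x∈S = connected-from v reach-C-x
        where
        reach-C-x : ∀ w → w ∈ C - x → Reach G (C - x) v w
        reach-C-x w w∈ with ∈⊕⁻ S v (-⊆ C x w∈)
        ... | inj₁ w∈S = around x∈S w∈S (∈-≢ C x w∈)
        ... | inj₂ refl = here w∈

  -- Vertices that can be spared are removed from `S` until all are essential; then `S ⊕ v` is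
  -- 2-connected and hence a clique.
  separate-bounded : ∀ k {v a b S} → ∣ S ∣ ≤ k → v ∉ S → v ~ a → v ~ b → Reach G S a b → Near a b
  separate-bounded k {v} {a} {b} {S} S≤k v∉S va vb r = decidable-stable (near? a b) λ ¬near →
    ¬near (inj₂ (twoConn⇒clique (n G) (S ⊕ v) (m≤n+m _ _)
      (cycle-twoConn v∉S va vb r λ y y∈S r′ → ¬near (smaller k S≤k y∈S r′)) a b
      (⊆⊕ S v (reach-source r)) (⊆⊕ S v (reach-target r)) (λ e → ¬near (inj₁ e))))
    where
    smaller : ∀ k → ∣ S ∣ ≤ k → ∀ {y} → y ∈ S → Reach G (S - y) a b → Near a b
    smaller zero S≤0 y∈S _ = contradiction (≤-trans (x∈p⇒∣p-x∣<∣p∣ y∈S) S≤0) λ ()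
    smaller (suc k) S≤k {y} y∈S r′ = separate-bounded k (ℕ.s≤s⁻¹ (≤-trans (x∈p⇒∣p-x∣<∣p∣ y∈S) S≤k))
      (λ v∈ → v∉S (-⊆ S y v∈)) va vb r′

  -- Neighbours of `v` that are connected without `v` share a block with it. All later arguments use
  -- the block graph hypothesis in this form.
  separate : ∀ {v a b S} → v ∉ S → v ~ a → v ~ b → Reach G S a b → Near a b
  separate {S = S} = separate-bounded ∣ S ∣ ≤-refl

  diamond : ∀ {v a b c} → v ~ a → v ~ b → v ~ c → a ~ c → c ~ b → Near a b
  diamond {v} {a} {b} {c} va vb vc ac cb =
    separate v∉ va vb (step (reach-edge a∈ ac c∈) cb b∈)
    where
    S = ⁅ a ⁆ ⊕ c ⊕ b
    a∈ : a ∈ S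
    a∈ = ⊆⊕ _ b (⊆⊕ _ c (x∈⁅x⁆ a))
    c∈ : c ∈ S
    c∈ = ⊆⊕ _ b (∈⊕ _ c)
    b∈ : b ∈ S
    b∈ = ∈⊕ _ b
    v∉ : v ∉ S
    v∉ v∈ with ∈⊕⁻ (⁅ a ⁆ ⊕ c) b v∈
    ... | inj₂ e = ~⇒≢ vb e
    ... | inj₁ v∈′ with ∈⊕⁻ ⁅ a ⁆ c v∈′
    ...   | inj₂ e = ~⇒≢ vc e
    ...   | inj₁ v∈″ = ~⇒≢ va (x∈⁅y⁆⇒x≡y a v∈″)

-- Induced copies of T₃

module TailedTriangle (G : Graph) (block : IsBlockGraph G) where

  open Separation G block public

  near-sym : ∀ {u v} → Near u v → Near v u
  near-sym (inj₁ e) = inj₁ (≡-sym e)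
  near-sym (inj₂ e) = inj₂ (~-sym e)

  near-join : ∀ {v p s t} → v ~ p → v ~ s → v ~ t → Near p s → Near p t → Near s t
  near-join _ _ _ (inj₁ refl) near = near
  near-join _ _ _ (inj₂ e) (inj₁ refl) = inj₂ (~-sym e)
  near-join vp vs vt (inj₂ ps) (inj₂ pt) = diamond vs vt vp (~-sym ps) pt

  private
    avoid : ∀ {v x : V} → x ≢ v → x ∈ full - v
    avoid x≢v = x∈p∧x≢y⇒x∈p-y ∈⊤ x≢v

  -- Here `w` separates `p` from `x`: if `s` were near `x`, its connection to `p` avoiding `w` would
  -- join the two neighbours `x` and `p` of `w`.
  far : ∀ {w p x s} → w ~ x → w ~ p → ¬ Near p x → Reach G (full - w) s p → ¬ Near s x
  far wx wp ¬near r (inj₁ refl) = ¬near (near-sym (separate (∉- full _) wx wp r))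
  far wx wp ¬near r (inj₂ sx) = ¬near (near-sym (separate (∉- full _) wx wp
    (reach-trans (reach-edge (avoid (λ e → ~⇒≢ wx (≡-sym e))) (~-sym sx) (reach-source r)) r)))

  -- A path of length two leaving a corner `c` of a triangle in which `e` is another corner. Two
  -- non-adjacencies are recorded; the block structure forces the others.
  record Tail (c e c₁ c₂ : V) : Set where
    field
      base : c ~ c₁
      end  : c₁ ~ c₂
      far₁ : ¬ Near e c₁
      far₂ : ¬ Near c c₂

  open Tail

  tail-swap : ∀ {c e f c₁ c₂} → c ~ e → c ~ f → e ~ f → Tail c e c₁ c₂ → Tail c f c₁ c₂
  tail-swap ce cf ef t = record
    { base = base t ; end = end t ; far₂ = far₂ t
    ; far₁ = far (base t) ce (far₁ t) (reach-edge (avoid (λ q → ~⇒≢ cf (≡-sym q))) (~-sym ef) (avoid (λ q → ~⇒≢ ce (≡-sym q)))) }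

  private
    ≢-of : ∀ {s x} → ¬ Near s x → s ≢ x
    ≢-of ¬near e = ¬near (inj₁ e)

  module _ {c e c₁ c₂} (ce : c ~ e) (t : Tail c e c₁ c₂) where

    corner-end : ¬ Near e c₂
    corner-end = far (end t) (~-sym (base t)) (far₂ t)
      (reach-edge (avoid (≢-of (far₁ t))) (~-sym ce) (avoid (~⇒≢ (base t))))

  module _ {c e c₁ c₂ e₁ e₂} (ce : c ~ e) (t : Tail c e c₁ c₂) (u : Tail e c e₁ e₂) where

    private
      reach-e : Reach G (full - c) e₁ e
      reach-e = reach-edge (avoid (λ q → far₁ u (inj₁ (≡-sym q)))) (~-sym (base u)) (avoid (λ q → ~⇒≢ ce (≡-sym q)))

    -- The cut vertex `c`, or `c₁` for `end-end`, separates the tail at `c` from `e` and the tail at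
    -- `e`; each time `far` is fed a walk along the tail at `e`.
    base-base : ¬ Near e₁ c₁
    base-base = far (base t) ce (far₁ t) reach-e

    end-base : ¬ Near e₂ c₁
    end-base = far (base t) ce (far₁ t)
      (reach-trans (reach-edge (avoid (λ q → corner-end (~-sym ce) u (inj₁ (≡-sym q)))) (~-sym (end u)) (reach-source reach-e)) reach-e)

    end-end : ¬ Near e₂ c₂
    end-end = far (end t) (~-sym (base t)) (far₂ t)
      (step (step (reach-edge (avoid (≢-of end-base)) (~-sym (end u)) (avoid (≢-of base-base)))
        (~-sym (base u)) (avoid (≢-of (far₁ t)))) (~-sym ce) (avoid (~⇒≢ (base t))))

  private
    adjacent : ∀ {u v} → u ~ v → adj G u v ≡ true
    adjacent {u} {v} = T⇒true (adj G u v)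
      where
      T⇒true : ∀ b → T b → b ≡ true
      T⇒true true _ = refl

    far-apart : ∀ {u v} → ¬ Near u v → adj G u v ≡ false
    far-apart {u} {v} ¬near = ¬T⇒false (adj G u v) (λ e → ¬near (inj₂ e))
      where
      ¬T⇒false : ∀ b → ¬ T b → b ≡ false
      ¬T⇒false true h = ⊥-elim (h _)
      ¬T⇒false false _ = refl

    apart-far : ∀ {u v} → ¬ Near u v → adj G v u ≡ false
    apart-far {u} {v} ¬near = far-apart (λ near → ¬near (near-sym near))

  -- No two vertices of T₃ have the same neighbours, so a map that reproduces the adjacency table is
  -- automatically injective.
  T3-rows-distinct : ∀ i j → (∀ k → T3adj i k ≡ T3adj j k) → i ≡ j
  T3-rows-distinct = toWitness {a? = Fin.all? λ i → Fin.all? λ j →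
    Fin.all? (λ k → T3adj i k Bool.≟ T3adj j k) →-dec (i Fin.≟ j)} _

  T3adj-sym : ∀ i j → T3adj i j ≡ T3adj j i
  T3adj-sym = toWitness {a? = Fin.all? λ i → Fin.all? λ j → T3adj i j Bool.≟ T3adj j i} _

  T3adj-irrefl : ∀ i → T3adj i i ≡ false
  T3adj-irrefl = toWitness {a? = Fin.all? λ i → T3adj i i Bool.≟ false} _

  module _ {p x y v d x₁ x₂ y₁ y₂} (px : p ~ x) (py : p ~ y) (xy : x ~ y)
           (tp : Tail p x v d) (tx : Tail x p x₁ x₂) (ty : Tail y p y₁ y₂) where

    private
      tp′ : Tail p y v d
      tp′ = tail-swap px py xy tp
      tx′ : Tail x y x₁ x₂
      tx′ = tail-swap (~-sym px) xy py tx
      ty′ : Tail y x y₁ y₂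
      ty′ = tail-swap (~-sym py) (~-sym xy) px ty

      -- The corners `p`, `x`, `y` take the positions 2, 3, 4 of the triangle; their tails, read
      -- outwards, take 1, 0 and 7, 8 and 5, 6.
      embed : Fin 9 → V
      embed 0F = d
      embed 1F = v
      embed 2F = p
      embed 3F = x
      embed 4F = y
      embed 5F = y₁
      embed 6F = y₂
      embed 7F = x₁
      embed 8F = x₂

      upper : ∀ i j → i Fin.< j → adj G (embed i) (embed j) ≡ T3adj i j
      upper 0F 1F _ = adjacent (~-sym (end tp))
      upper 0F 2F _ = apart-far (far₂ tp)
      upper 0F 3F _ = apart-far (corner-end px tp)
      upper 0F 4F _ = apart-far (corner-end py tp′)
      upper 0F 5F _ = far-apart (end-base (~-sym py) ty tp′)
      upper 0F 6F _ = far-apart (end-end (~-sym py) ty tp′)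
      upper 0F 7F _ = far-apart (end-base (~-sym px) tx tp)
      upper 0F 8F _ = far-apart (end-end (~-sym px) tx tp)
      upper 1F 2F _ = adjacent (~-sym (base tp))
      upper 1F 3F _ = apart-far (far₁ tp)
      upper 1F 4F _ = apart-far (far₁ tp′)
      upper 1F 5F _ = far-apart (base-base (~-sym py) ty tp′)
      upper 1F 6F _ = apart-far (end-base py tp′ ty)
      upper 1F 7F _ = far-apart (base-base (~-sym px) tx tp)
      upper 1F 8F _ = apart-far (end-base px tp tx)
      upper 2F 3F _ = adjacent (px)
      upper 2F 4F _ = adjacent (py)
      upper 2F 5F _ = far-apart (far₁ ty)
      upper 2F 6F _ = far-apart (corner-end (~-sym py) ty)
      upper 2F 7F _ = far-apart (far₁ tx)
      upper 2F 8F _ = far-apart (corner-end (~-sym px) tx)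
      upper 3F 4F _ = adjacent (xy)
      upper 3F 5F _ = far-apart (far₁ ty′)
      upper 3F 6F _ = far-apart (corner-end (~-sym xy) ty′)
      upper 3F 7F _ = adjacent (base tx)
      upper 3F 8F _ = far-apart (far₂ tx)
      upper 4F 5F _ = adjacent (base ty)
      upper 4F 6F _ = far-apart (far₂ ty)
      upper 4F 7F _ = far-apart (far₁ tx′)
      upper 4F 8F _ = far-apart (corner-end xy tx′)
      upper 5F 6F _ = adjacent (end ty)
      upper 5F 7F _ = far-apart (base-base xy tx′ ty′)
      upper 5F 8F _ = apart-far (end-base (~-sym xy) ty′ tx′)
      upper 6F 7F _ = far-apart (end-base xy tx′ ty′)
      upper 6F 8F _ = far-apart (end-end xy tx′ ty′)
      upper 7F 8F _ = adjacent (end tx)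
      upper (suc _) 1F (s≤s ())
      upper (suc (suc _)) 2F (s≤s (s≤s ()))
      upper (suc (suc (suc _))) 3F (s≤s (s≤s (s≤s ())))
      upper (suc (suc (suc (suc _)))) 4F (s≤s (s≤s (s≤s (s≤s ()))))
      upper (suc (suc (suc (suc (suc _))))) 5F (s≤s (s≤s (s≤s (s≤s (s≤s ())))))
      upper (suc (suc (suc (suc (suc (suc _)))))) 6F (s≤s (s≤s (s≤s (s≤s (s≤s (s≤s ()))))))
      upper (suc (suc (suc (suc (suc (suc (suc _))))))) 7F (s≤s (s≤s (s≤s (s≤s (s≤s (s≤s (s≤s ())))))))
      upper (suc (suc (suc (suc (suc (suc (suc (suc _)))))))) 8F (s≤s (s≤s (s≤s (s≤s (s≤s (s≤s (s≤s (s≤s ()))))))))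

      table : ∀ i j → adj G (embed i) (embed j) ≡ T3adj i j
      table i j with Fin.<-cmp i j
      ... | tri< i<j _ _ = upper i j i<j
      ... | tri≈ _ refl _ = trans (irrefl G (embed i)) (≡-sym (T3adj-irrefl i))
      ... | tri> _ _ j<i = trans (Graph.sym G (embed i) (embed j)) (trans (upper j i j<i) (T3adj-sym j i))

    tailed-triangle⇒T3 : HasInducedT3 G
    tailed-triangle⇒T3 = embed , (λ {i} {j} e → T3-rows-distinct i j λ k →
      trans (≡-sym (table i k)) (trans (cong (λ u → adj G u (embed k)) e) (table j k))) , table

-- Simplicial vertices of minors

module Minor (G : Graph) (block : IsBlockGraph G) (T3-free : T3Free G) where

  open TailedTriangle G block
  open Chordal (Ind G 3) (independent? 3) (independent-⊆ 3)

  module _ {W H : Subset (n G)} (W⊆H : W ⊆ H)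
           (none-simplicial : ∀ v → v ∈ H → v ∉ W → ¬ Simplicial W H v) where

    -- Witnesses against simpliciality of `v`. The sets `M` and `Z⁺` are faces containing `W`, and
    -- contradictions come from connected 4-sets inside one of them.
    record Violation (v : V) : Set where
      field
        X Y : Subset (n G)
        W⊆X : W ⊆ X
        W⊆Y : W ⊆ Y
        X⊆H : X ⊆ H
        Y⊆H : Y ⊆ H
        v∉X : v ∉ X
        v∉Y : v ∉ Y
        indM : Ind G 3 (X ∪ Y)
        ¬indX : ¬ Ind G 3 (X ⊕ v)
        ¬indY : ¬ Ind G 3 (Y ⊕ v)
        indZ : Ind G 3 ((X ∩ Y) ⊕ v)

      M Z⁺ : Subset (n G)
      M = X ∪ Y
      Z⁺ = (X ∩ Y) ⊕ v

      X⊆M : X ⊆ M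
      X⊆M = p⊆p∪q Y
      Y⊆M : Y ⊆ M
      Y⊆M = q⊆p∪q X Y
      W⊆M : W ⊆ M
      W⊆M w∈W = X⊆M (W⊆X w∈W)
      v∈Z⁺ : v ∈ Z⁺
      v∈Z⁺ = ∈⊕ (X ∩ Y) v
      XY⊆Z⁺ : ∀ {x} → x ∈ X → x ∈ Y → x ∈ Z⁺
      XY⊆Z⁺ x∈X x∈Y = ⊆⊕ (X ∩ Y) v (x∈p∩q⁺ (x∈X , x∈Y))
      Z⁺⊆ : ∀ {x} → x ∈ Z⁺ → x ≢ v → x ∈ X × x ∈ Y
      Z⁺⊆ x∈ x≢v with ∈⊕⁻ (X ∩ Y) v x∈
      ... | inj₁ x∈Z = x∈p∩q⁻ X Y x∈Z
      ... | inj₂ x≡v = ⊥-elim (x≢v x≡v)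
      W⊆Z⁺ : W ⊆ Z⁺
      W⊆Z⁺ w∈W = XY⊆Z⁺ (W⊆X w∈W) (W⊆Y w∈W)
      growX : ∀ {C} → v ∈ C → ∣ C ∣ ≤ 3 → Escape X C
      growX = grow 3 (independent-⊆ 3 X⊆M indM) ¬indX
      X≢v : ∀ {x} → x ∈ X → x ≢ v
      X≢v x∈X refl = v∉X x∈X

    open Violation

    -- A double negation suffices, since every use aims at a contradiction.
    violated : ∀ {v} → v ∈ H → v ∉ W → ¬ ¬ Violation v
    violated {v} v∈H v∉W ¬viol = none-simplicial v v∈H v∉W
      λ X Y W⊆X W⊆Y X⊆H Y⊆H v∉X v∉Y indM ¬indX ¬indY indZ → ¬viol record
        { X = X ; Y = Y ; W⊆X = W⊆X ; W⊆Y = W⊆Y ; X⊆H = X⊆H ; Y⊆H = Y⊆H ; v∉X = v∉X ; v∉Y = v∉Y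
        ; indM = indM ; ¬indX = ¬indX ; ¬indY = ¬indY ; indZ = indZ }

    flip : ∀ {v} → Violation v → Violation v
    flip b = record
      { X = Y b ; Y = X b ; W⊆X = W⊆Y b ; W⊆Y = W⊆X b ; X⊆H = Y⊆H b ; Y⊆H = X⊆H b ; v∉X = v∉Y b ; v∉Y = v∉X b
      ; indM = independent-⊆ 3 (∪-least (Y⊆M b) (X⊆M b)) (indM b) ; ¬indX = ¬indY b ; ¬indY = ¬indX b
      ; indZ = independent-⊆ 3 (flip-Z⁺ b) (indZ b) }
      where
      flip-Z⁺ : ∀ {v} (b : Violation v) → (Y b ∩ X b) ⊕ v ⊆ Z⁺ b
      flip-Z⁺ b = ⊕-least (λ x∈ → XY⊆Z⁺ b (p∩q⊆q (Y b) (X b) x∈) (p∩q⊆p (Y b) (X b) x∈)) (v∈Z⁺ b)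

    closed-flip : ∀ {v C} (b : Violation v) → Closed (Z⁺ b) C → Closed (Z⁺ (flip b)) C
    closed-flip {v} b cl c∈C y∈ e with ∈⊕⁻ (Y b ∩ X b) v y∈
    ... | inj₁ y∈′ = cl c∈C (XY⊆Z⁺ b (p∩q⊆q (Y b) (X b) y∈′) (p∩q⊆p (Y b) (X b) y∈′)) e
    ... | inj₂ refl = cl c∈C (v∈Z⁺ b) e

    -- Growing a connected set around a vertex

    pair : V → V → Subset (n G)
    pair a b = ⁅ a ⁆ ⊕ b

    ∣pair∣≤2 : ∀ a b → ∣ pair a b ∣ ≤ 2
    ∣pair∣≤2 a b = ≤-trans (∣p⊕x∣≤1+∣p∣ ⁅ a ⁆ b) (s≤s (≤-reflexive (∣⁅x⁆∣≡1 a)))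

    ∣triple∣≤3 : ∀ a b c → ∣ pair a b ⊕ c ∣ ≤ 3
    ∣triple∣≤3 a b c = ≤-trans (∣p⊕x∣≤1+∣p∣ (pair a b) c) (s≤s (∣pair∣≤2 a b))

    ∈pair₁ : ∀ a b → a ∈ pair a b
    ∈pair₁ a b = ⊆⊕ ⁅ a ⁆ b (x∈⁅x⁆ a)

    ∈pair₂ : ∀ a b → b ∈ pair a b
    ∈pair₂ a b = ∈⊕ ⁅ a ⁆ b

    ∈pair⁻ : ∀ a b {x} → x ∈ pair a b → x ≡ a ⊎ x ≡ b
    ∈pair⁻ a b x∈ with ∈⊕⁻ ⁅ a ⁆ b x∈
    ... | inj₁ x∈a = inj₁ (x∈⁅y⁆⇒x≡y a x∈a)
    ... | inj₂ e = inj₂ e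

    ∉⊕⇒≢ : ∀ (C : Subset (n G)) {c x} → x ∉ C ⊕ c → x ≢ c
    ∉⊕⇒≢ C {c} x∉ refl = x∉ (∈⊕ C c)

    ∉⇒≢ : ∀ {C : Subset (n G)} {c x} → c ∈ C → x ∉ C → x ≢ c
    ∉⇒≢ c∈C x∉C refl = x∉C c∈C

    record Growth (v : V) (X : Subset (n G)) : Set where
      field
        {x₁ x₂ x₃} : V
        x₁∈ : x₁ ∈ X
        x₂∈ : x₂ ∈ X
        x₃∈ : x₃ ∈ X
        e₁ : v ~ x₁
        e₂ : v ~ x₂ ⊎ x₁ ~ x₂
        e₃ : v ~ x₃ ⊎ x₁ ~ x₃ ⊎ x₂ ~ x₃
        x₁≢x₂ : x₁ ≢ x₂
        x₁≢x₃ : x₁ ≢ x₃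
        x₂≢x₃ : x₂ ≢ x₃

    -- Three rounds of `grow`, starting from sets with one, two and three elements, collect vertices
    -- of `X` that are connected together with `v`.
    growth : ∀ {v} (b : Violation v) → Growth v (X b)
    growth {v} b
      with c₁ , x₁ , c₁∈ , x₁∈ , x₁∉ , e₁ ← growX b {⁅ v ⁆} (x∈⁅x⁆ v) (≤-trans (≤-reflexive (∣⁅x⁆∣≡1 v)) (s≤s z≤n))
      with refl ← x∈⁅y⁆⇒x≡y v c₁∈
      with c₂ , x₂ , c₂∈ , x₂∈ , x₂∉ , e₂ ← growX b {pair v x₁} (∈pair₁ v x₁) (≤-trans (∣pair∣≤2 v x₁) (n≤1+n 2))
      with c₃ , x₃ , c₃∈ , x₃∈ , x₃∉ , e₃ ← growX b {pair v x₁ ⊕ x₂} (⊆⊕ _ x₂ (∈pair₁ v x₁)) (∣triple∣≤3 v x₁ x₂) = record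
      { x₁∈ = x₁∈ ; x₂∈ = x₂∈ ; x₃∈ = x₃∈ ; e₁ = e₁ ; e₂ = e₂′ ; e₃ = e₃′
      ; x₁≢x₂ = λ q → ∉⇒≢ (∈pair₂ v x₁) x₂∉ (≡-sym q)
      ; x₁≢x₃ = λ q → ∉⇒≢ (⊆⊕ _ x₂ (∈pair₂ v x₁)) x₃∉ (≡-sym q)
      ; x₂≢x₃ = λ q → ∉⊕⇒≢ (pair v x₁) x₃∉ (≡-sym q) }
      where
      e₂′ : v ~ x₂ ⊎ x₁ ~ x₂
      e₂′ with ∈pair⁻ v x₁ c₂∈
      ... | inj₁ refl = inj₁ e₂
      ... | inj₂ refl = inj₂ e₂
      e₃′ : v ~ x₃ ⊎ x₁ ~ x₃ ⊎ x₂ ~ x₃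
      e₃′ with ∈⊕⁻ (pair v x₁) x₂ c₃∈
      ... | inj₂ refl = inj₂ (inj₂ e₃)
      ... | inj₁ c₃∈′ with ∈pair⁻ v x₁ c₃∈′
      ...   | inj₁ refl = inj₁ e₃
      ...   | inj₂ refl = inj₂ (inj₁ e₃)

    ≢∧near⇒~ : ∀ {u v} → u ≢ v → Near u v → u ~ v
    ≢∧near⇒~ u≢v (inj₁ e) = ⊥-elim (u≢v e)
    ≢∧near⇒~ u≢v (inj₂ e) = e

    -- The three vertices collected from X already form a whole component of X ∪ Y, so the three
    -- collected from Y lie in X ∩ Y.
    clique-neighbourhood : ∀ {v} → (∀ {s t} → s ∈ H → t ∈ H → v ~ s → v ~ t → Near s t) → ¬ Violation v
    clique-neighbourhood {v} clique b =
      no-connected-4-set (indZ b) (v∈Z⁺ b) (in-Z⁺ y₁∈ in₁) (in-Z⁺ y₂∈ in₂) (in-Z⁺ y₃∈ in₃) f₁ f₂ f₃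
        (λ q → X≢v (flip b) y₂∈ (≡-sym q)) y₁≢y₂ (λ q → X≢v (flip b) y₃∈ (≡-sym q)) y₁≢y₃ y₂≢y₃
      where
      open Growth (growth b)
      open Growth (growth (flip b)) renaming
        (x₁ to y₁; x₂ to y₂; x₃ to y₃; x₁∈ to y₁∈; x₂∈ to y₂∈; x₃∈ to y₃∈; e₁ to f₁; e₂ to f₂; e₃ to f₃;
         x₁≢x₂ to y₁≢y₂; x₁≢x₃ to y₁≢y₃; x₂≢x₃ to y₂≢y₃)
      Listed : V → Set
      Listed m = m ≡ x₁ ⊎ m ≡ x₂ ⊎ m ≡ x₃
      listed? : ∀ m → Dec (Listed m)
      listed? m = (m Fin.≟ x₁) ⊎-dec (m Fin.≟ x₂) ⊎-dec (m Fin.≟ x₃)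
      x₁~ : ∀ {x} → x ∈ X b → x₁ ≢ x → v ~ x → x₁ ~ x
      x₁~ x∈ x₁≢x vx = ≢∧near⇒~ x₁≢x (clique (X⊆H b x₁∈) (X⊆H b x∈) e₁ vx)
      x₁~x₂ : x₁ ~ x₂
      x₁~x₂ = [ x₁~ x₂∈ x₁≢x₂ , id ]′ e₂
      x₃-attached : x₁ ~ x₃ ⊎ x₂ ~ x₃
      x₃-attached = [ inj₁ ∘ x₁~ x₃∈ x₁≢x₃ , id ]′ e₃
      absorb : ∀ {m} → m ∈ Y b → x₁ ~ m ⊎ x₂ ~ m ⊎ x₃ ~ m → Listed m
      absorb {m} m∈ e = decidable-stable (listed? m) λ ¬l →
        no-connected-4-set (indM b) (X⊆M b x₁∈) (X⊆M b x₂∈) (X⊆M b x₃∈) (Y⊆M b m∈) x₁~x₂ x₃-attached e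
          x₁≢x₃ x₂≢x₃ (λ q → ¬l (inj₁ (≡-sym q))) (λ q → ¬l (inj₂ (inj₁ (≡-sym q)))) (λ q → ¬l (inj₂ (inj₂ (≡-sym q))))
      absorb-~ : ∀ {l m} → Listed l → m ∈ Y b → l ~ m → Listed m
      absorb-~ (inj₁ refl) m∈ e = absorb m∈ (inj₁ e)
      absorb-~ (inj₂ (inj₁ refl)) m∈ e = absorb m∈ (inj₂ (inj₁ e))
      absorb-~ (inj₂ (inj₂ refl)) m∈ e = absorb m∈ (inj₂ (inj₂ e))
      absorb-v : ∀ {m} → m ∈ Y b → v ~ m → Listed m
      absorb-v m∈ vm with clique (X⊆H b x₁∈) (Y⊆H b m∈) e₁ vm
      ... | inj₁ refl = inj₁ refl
      ... | inj₂ e = absorb m∈ (inj₁ e)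
      in₁ : Listed y₁
      in₁ = absorb-v y₁∈ f₁
      in₂ : Listed y₂
      in₂ = [ absorb-v y₂∈ , absorb-~ in₁ y₂∈ ]′ f₂
      in₃ : Listed y₃
      in₃ = [ absorb-v y₃∈ , [ absorb-~ in₁ y₃∈ , absorb-~ in₂ y₃∈ ]′ ]′ f₃
      in-Z⁺ : ∀ {m} → m ∈ Y b → Listed m → m ∈ Z⁺ b
      in-Z⁺ m∈ (inj₁ refl) = XY⊆Z⁺ b x₁∈ m∈
      in-Z⁺ m∈ (inj₂ (inj₁ refl)) = XY⊆Z⁺ b x₂∈ m∈
      in-Z⁺ m∈ (inj₂ (inj₂ refl)) = XY⊆Z⁺ b x₃∈ m∈

    -- Induced paths and their longest representatives

    NearM : Maybe V → V → Set
    -- A root has no predecessor, so every vertex counts as lying beyond it.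
    NearM nothing x = ⊥
    NearM (just p) x = Near p x

    nearM? : ∀ m x → Dec (NearM m x)
    nearM? nothing x = no λ ()
    nearM? (just p) x = near? p x

    Link : Maybe V → V → Set
    Link nothing v = ⊤
    Link (just p) v = p ~ v

    nearM-join : ∀ m {v s t} → Link m v → v ~ s → v ~ t → NearM m s → NearM m t → Near s t
    nearM-join (just p) pv vs vt = near-join (~-sym pv) vs vt

    -- The vertices `p`, `v`, `x` form a triangle, so a predecessor of `p` near `x` would by
    -- `diamond` also be near `v`.
    ¬nearM-transfer : ∀ m {p v x} → Link m p → p ~ v → p ~ x → v ~ x → ¬ NearM m v → ¬ NearM m x
    ¬nearM-transfer (just q) qp pv px vx ¬near (inj₁ refl) = ¬near (inj₂ (~-sym vx))
    ¬nearM-transfer (just q) qp pv px vx ¬near (inj₂ qx) = ¬near (diamond (~-sym qp) pv px qx (~-sym vx))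

    -- Otherwise all neighbours of `u` in `H` are near its predecessor, hence near each other, or
    -- there are none; then `clique-neighbourhood` makes `u` simplicial.
    beyond : ∀ m {u} → u ∈ H → u ∉ W → Link m u → ∃[ u′ ] (u′ ∈ H × u ~ u′ × ¬ NearM m u′)
    beyond m {u} u∈H u∉W link with Fin.any? (λ u′ → (u′ ∈? H) ×-dec (u ~? u′) ×-dec ¬? (nearM? m u′))
    ... | yes r = r
    ... | no ¬u′ = ⊥-elim (violated u∈H u∉W (clique-neighbourhood λ s∈H t∈H us ut →
            nearM-join m link us ut (near s∈H us) (near t∈H ut)))
      where
      near : ∀ {s} → s ∈ H → u ~ s → NearM m s
      near {s} s∈H us = decidable-stable (nearM? m s) λ ¬near → ¬u′ (s , s∈H , us , ¬near)

    -- Path m S v is an induced path in H from some root to v; m is the predecessor of v and S the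
    -- set of vertices before v. In a block graph it suffices to forbid chords of length two.
    data Path : Maybe V → Subset (n G) → V → Set where
      start  : ∀ {v} → v ∈ H → Path nothing ∅ v
      extend : ∀ {m S v x} → Path m S v → v ~ x → ¬ NearM m x → x ∈ H → Path (just v) (S ⊕ v) x

    path-end : ∀ {m S v} → Path m S v → v ∈ H
    path-end (start v∈H) = v∈H
    path-end (extend _ _ _ v∈H) = v∈H

    path-link : ∀ {m S v} → Path m S v → Link m v
    path-link (start _) = tt
    path-link (extend _ e _ _) = e

    path-connected : ∀ {m S v} → Path m S v → ∀ {s} → s ∈ S → ∃[ p ] (m ≡ just p × Reach G S s p)
    -- A repeated vertex `x` would be connected within the earlier vertices to the predecessor of
    -- `v`, and `separate` at `v` would make it near that predecessor, a forbidden chord.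
    path-fresh : ∀ {m S v} → Path m S v → v ∉ S

    path-connected (start _) s∈∅ = ⊥-elim (∉⊥ s∈∅)
    path-connected (extend {m} {S} {v} P _ _ _) {s} s∈ with ∈⊕⁻ S v s∈
    ... | inj₂ refl = v , refl , here (∈⊕ S v)
    ... | inj₁ s∈S with p , refl , r ← path-connected P s∈S =
      v , refl , step (reach-mono (⊆⊕ S v) r) (path-link P) (∈⊕ S v)

    path-fresh (start _) v∈∅ = ∉⊥ v∈∅
    path-fresh (extend {m} {S} {v} {x} P vx ¬near _) x∈ with ∈⊕⁻ S v x∈
    ... | inj₂ refl = ~⇒≢ vx refl
    ... | inj₁ x∈S with p , refl , r ← path-connected P x∈S =
      ¬near (near-sym (separate (path-fresh P) vx (~-sym (path-link P)) r))

    path-longer : ∀ {m S v} → Path m S v → ∣ S ∣ ℕ.< ∣ S ⊕ v ∣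
    path-longer P = 1+∣p∣≤∣p⊕x∣ (path-fresh P)

    -- Only paths ending outside `W` compete; their length is the number of vertices before the end.
    Longest : ℕ → Set
    Longest k = ∀ {m S v} → Path m S v → v ∉ W → ¬ (k ℕ.< ∣ S ∣)

    module Tip {m S v} (P : Path m S v) (v∉W : v ∉ W) (longest : Longest ∣ S ∣) where

      child∈W : ∀ {d} → v ~ d → d ∈ H → ¬ NearM m d → d ∈ W
      child∈W {d} vd d∈H ¬near = decidable-stable (d ∈? W) λ d∉W →
        longest (extend P vd ¬near d∈H) d∉W (path-longer P)

      -- The prolonged path runs through `d ∈ W`, which is harmless because only its end has to
      -- avoid `W`.
      grandchild∈W : ∀ {d e} → v ~ d → d ∈ H → ¬ NearM m d → d ~ e → e ∈ H → ¬ Near v e → e ∈ W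
      grandchild∈W {d} {e} vd d∈H ¬near de e∈H ¬near′ = decidable-stable (e ∈? W) λ e∉W →
        let P′ = extend P vd ¬near d∈H in
        longest (extend P′ de ¬near′ e∈H) e∉W (≤-trans (path-longer P) (≤-trans (n≤1+n _) (path-longer P′)))

      near-if-∉W : ∀ {x} → v ~ x → x ∈ H → x ∉ W → NearM m x
      near-if-∉W {x} vx x∈H x∉W = decidable-stable (nearM? m x) λ ¬near → x∉W (child∈W vx x∈H ¬near)

      child-edge : ∀ {d x} → v ~ d → d ∈ H → ¬ NearM m d → d ~ x → x ∈ H → x ∉ W → x ≢ v → v ~ x
      child-edge {d} {x} vd d∈H ¬near dx x∈H x∉W x≢v = ≢∧near⇒~ (λ q → x≢v (≡-sym q))
        (decidable-stable (near? v x) λ ¬near′ → x∉W (grandchild∈W vd d∈H ¬near dx x∈H ¬near′))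

      -- If `x` were not near `d`, a path through `d` and `z` would reach it and be too long; so `x`
      -- is adjacent to the child `d`, and `child-edge` applies.
      grandchild-edge : ∀ {d z x} → v ~ d → d ∈ H → ¬ NearM m d → d ~ z → z ∈ H → ¬ Near v z →
                        z ~ x → x ∈ H → x ∉ W → x ≢ v → x ≢ d → v ~ x
      grandchild-edge {d} {z} {x} vd d∈H ¬near dz z∈H ¬near′ zx x∈H x∉W x≢v x≢d =
        child-edge vd d∈H ¬near (≢∧near⇒~ (λ q → x≢d (≡-sym q)) (decidable-stable (near? d x) λ ¬near″ →
          let P′ = extend P vd ¬near d∈H
              P″ = extend P′ dz ¬near′ z∈H in
          longest (extend P″ zx ¬near″ x∈H) x∉W
            (≤-trans (path-longer P) (≤-trans (n≤1+n _) (≤-trans (path-longer P′) (≤-trans (n≤1+n _) (path-longer P″)))))))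
          x∈H x∉W x≢v

    -- Descendants in `W` of the end of a longest path

    record SecondDescendant (m : Maybe V) (v : V) : Set where
      field
        {d z} : V
        d∈W : d ∈ W
        v~d : v ~ d
        d-far : ¬ NearM m d
        z∈W : z ∈ W
        z≢v : z ≢ v
        z≢d : z ≢ d
        z-attached : v ~ z ⊎ d ~ z
        -- Excludes vertices in the clique of `v` and its predecessor.
        z-below : ¬ (v ~ z × NearM m z)

    module Core {m S v} (P : Path m S v) (v∉W : v ∉ W) (longest : Longest ∣ S ∣)
                {d} (d∈W : d ∈ W) (vd : v ~ d) (d-far : ¬ NearM m d) where

      open Tip P v∉W longest

      private
        C₂ : Subset (n G)
        C₂ = pair v d

      pair-edge : ∀ {c x} → c ∈ C₂ → c ~ x → x ∈ H → x ∉ W → x ≢ v → v ~ x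
      pair-edge c∈ cx x∈H x∉W x≢v with ∈pair⁻ v d c∈
      ... | inj₁ refl = cx
      ... | inj₂ refl = child-edge vd (W⊆H d∈W) d-far cx x∈H x∉W x≢v

      private
        ∉W : (b : Violation v) → ∀ {x} → x ∉ Y b → x ∉ W
        ∉W b x∉Y x∈W = x∉Y (W⊆Y b x∈W)

        d∈Z⁺ : (b : Violation v) → d ∈ Z⁺ b
        d∈Z⁺ b = W⊆Z⁺ b d∈W

      record Branch (b : Violation v) : Set where
        field
          {x x′} : V
          x∈X  : x ∈ X b
          x∉Y  : x ∉ Y b
          vx   : v ~ x
          near : NearM m x
          x′∈X : x′ ∈ X b
          x′≢d : x′ ≢ d
          x≢x′ : x ≢ x′
          xx′  : x ~ x′

      -- Closedness of the pair in `Z⁺` puts the first escape `x` outside `Y` and thus outside `W`,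
      -- so `x` lies in the clique of `v` and its predecessor. The second escape `x′` is attached to
      -- `x` or, by the same reasoning, lies in that clique too.
      branch : ∀ b → Closed (Z⁺ b) C₂ → Branch b
      branch b cl
        with c , x , c∈ , x∈X , x∉ , cx ← growX b {C₂} (∈pair₁ v d) (≤-trans (∣pair∣≤2 v d) (n≤1+n 2))
        with c′ , x′ , c′∈ , x′∈X , x′∉ , c′x′ ← growX b {C₂ ⊕ x} (⊆⊕ C₂ x (∈pair₁ v d)) (∣triple∣≤3 v d x) = record
        { x∈X = x∈X ; x∉Y = x∉Y ; vx = vx ; near = near ; x′∈X = x′∈X
        ; x′≢d = ∉⇒≢ (⊆⊕ C₂ x (∈pair₂ v d)) x′∉ ; x≢x′ = x≢x′ ; xx′ = xx′ }
        where
        x∉Y : x ∉ Y b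
        x∉Y x∈Y = x∉ (cl c∈ (XY⊆Z⁺ b x∈X x∈Y) cx)
        vx : v ~ x
        vx = pair-edge c∈ cx (X⊆H b x∈X) (∉W b x∉Y) (X≢v b x∈X)
        near : NearM m x
        near = near-if-∉W vx (X⊆H b x∈X) (∉W b x∉Y)
        x≢x′ : x ≢ x′
        x≢x′ q = ∉⊕⇒≢ C₂ x′∉ (≡-sym q)
        xx′ : x ~ x′
        xx′ with ∈⊕⁻ C₂ x c′∈
        ... | inj₂ refl = c′x′
        ... | inj₁ c′∈C₂ = ≢∧near⇒~ x≢x′ (nearM-join m (path-link P) vx vx′ near (near-if-∉W vx′ (X⊆H b x′∈X) x′∉W))
          where
          x′∉W : x′ ∉ W
          x′∉W x′∈W = x′∉ (⊆⊕ C₂ x (cl c′∈C₂ (W⊆Z⁺ b x′∈W) c′x′))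
          vx′ : v ~ x′
          vx′ = pair-edge c′∈C₂ c′x′ (X⊆H b x′∈X) x′∉W (X≢v b x′∈X)

      module _ {b : Violation v} (cl : Closed (Z⁺ b) C₂) (s : Branch b) (t : Branch (flip b)) where

        open Branch s
        open Branch t renaming
          (x to y; x′ to y′; x∈X to y∈Y; x∉Y to y∉X; vx to vy; near to near-y; x′∈X to y′∈Y; x′≢d to y′≢d;
           x≢x′ to y≢y′; xx′ to yy′)

        private
          xy : x ~ y
          xy = ≢∧near⇒~ (λ q → y∉X (subst (_∈ X b) q x∈X)) (nearM-join m (path-link P) vx vy near near-y)

        -- A common end would be adjacent to `v` by `diamond` at `x`, and it lies in `X ∩ Y`;
        -- closedness then forces it into `pair v d`.
        common-end : x′ ≡ y′ → ⊥
        common-end q with diamond (~-sym vx) xx′ xy vy (subst (y ~_) (≡-sym q) yy′)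
        ... | inj₁ e = v∉X b (subst (_∈ X b) (≡-sym e) x′∈X)
        ... | inj₂ vx′ with ∈pair⁻ v d (cl (∈pair₁ v d) (XY⊆Z⁺ b x′∈X (subst (_∈ Y b) (≡-sym q) y′∈Y)) vx′)
        ...   | inj₁ e = v∉X b (subst (_∈ X b) e x′∈X)
        ...   | inj₂ e = x′≢d e

        -- The two branches together form the walk `x′`, `x`, `y`, `y′` inside `M`.
        branches-clash : ⊥
        branches-clash = no-connected-4-set (indM b) (X⊆M b x∈X) (Y⊆M b y∈Y) (X⊆M b x′∈X) (Y⊆M b y′∈Y)
          xy (inj₁ xx′) (inj₂ (inj₁ yy′)) x≢x′ (λ q → y∉X (subst (_∈ X b) (≡-sym q) x′∈X))
          (λ q → x∉Y (subst (_∈ Y b) (≡-sym q) y′∈Y)) y≢y′ common-end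

      not-closed : (b : Violation v) → ¬ Closed (Z⁺ b) C₂
      not-closed b cl = branches-clash cl (branch b cl) (branch (flip b) (closed-flip b cl))

      module _ {a} (va : v ~ a) (a-near : NearM m a) (a≢d : a ≢ d) where

        -- As `v`, `d`, `a` already form a connected triple in `Z⁺`, the next escape `x` cannot lie
        -- in `Y`.
        third : ∀ b → a ∈ X b → a ∈ Y b → ∃[ x ] (x ∈ X b × x ∉ Y b × a ~ x)
        third b a∈X a∈Y
          with c , x , c∈ , x∈X , x∉ , cx ← growX b {C₂ ⊕ a} (⊆⊕ C₂ a (∈pair₁ v d)) (∣triple∣≤3 v d a) =
          x , x∈X , x∉Y , ax
          where
          attached : v ~ x ⊎ d ~ x ⊎ a ~ x
          attached with ∈⊕⁻ C₂ a c∈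
          ... | inj₂ refl = inj₂ (inj₂ cx)
          ... | inj₁ c∈C₂ with ∈pair⁻ v d c∈C₂
          ...   | inj₁ refl = inj₁ cx
          ...   | inj₂ refl = inj₂ (inj₁ cx)
          x≢a : x ≢ a
          x≢a = ∉⊕⇒≢ C₂ x∉
          x∉Y : x ∉ Y b
          x∉Y x∈Y = no-connected-4-set (indZ b) (v∈Z⁺ b) (d∈Z⁺ b) (XY⊆Z⁺ b a∈X a∈Y) (XY⊆Z⁺ b x∈X x∈Y)
            vd (inj₁ va) attached (λ q → X≢v b a∈X (≡-sym q)) (λ q → a≢d (≡-sym q))
            (λ q → X≢v b x∈X (≡-sym q)) (λ q → ∉⇒≢ (⊆⊕ C₂ a (∈pair₂ v d)) x∉ (≡-sym q)) (λ q → x≢a (≡-sym q))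
          ax : a ~ x
          ax with ∈⊕⁻ C₂ a c∈
          ... | inj₂ refl = cx
          ... | inj₁ c∈C₂ = ≢∧near⇒~ (λ q → x≢a (≡-sym q)) (nearM-join m (path-link P) va vx a-near
                  (near-if-∉W vx (X⊆H b x∈X) (∉W b x∉Y)))
            where
            vx : v ~ x
            vx = pair-edge c∈C₂ cx (X⊆H b x∈X) (∉W b x∉Y) (X≢v b x∈X)

    module Siblings {m S p v} (P : Path m S p) (pv : p ~ v) (v-far : ¬ NearM m v)
                    (longest : Longest ∣ S ⊕ p ∣) where

      -- A sibling of `v` outside `W` ends a path as long as that of `v`, so its children lie in `W`
      -- as well.
      sibling-child : ∀ {x} → p ~ x → ¬ NearM m x → x ∈ H → x ∉ W → ∃[ e ] (e ∈ W × x ~ e × ¬ Near p e)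
      sibling-child {x} px ¬near x∈H x∉W =
        let e , e∈H , xe , ¬near′ = beyond (just p) x∈H x∉W px
        in e , Tip.child∈W (extend P px ¬near x∈H) x∉W longest xe e∈H ¬near′ , xe , ¬near′

      module _ {d M a x y} (vd : v ~ d) (d-far : ¬ Near p d)
               (W⊆M : W ⊆ M) (indM : Ind G 3 M) (a∈M : a ∈ M) (x∈M : x ∈ M) (y∈M : y ∈ M)
               (x∉W : x ∉ W) (y∉W : y ∉ W) (x∈H : x ∈ H) (y∈H : y ∈ H) (a∈H : a ∈ H)
               (va : v ~ a) (a-near : Near p a) (ax : a ~ x) (ay : a ~ y) (x≢y : x ≢ y) where

        fourth : ∀ {w} → w ∈ W → w ≢ a → a ~ w ⊎ x ~ w ⊎ y ~ w → ⊥
        fourth {w} w∈W w≢a e = no-connected-4-set indM a∈M x∈M y∈M (W⊆M w∈W) ax (inj₁ ay) e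
          (~⇒≢ ay) x≢y (λ q → w≢a (≡-sym q)) (λ { refl → x∉W w∈W }) (λ { refl → y∉W w∈W })

        -- If `s` were a sibling of `v`, its child in `W` would be a fourth vertex attached to `a`,
        -- `x`, `y` inside `M`.
        no-sibling : ∀ {s} → s ∈ H → s ∉ W → (∀ {w} → s ~ w → a ~ w ⊎ x ~ w ⊎ y ~ w) → p ~ s → NearM m s
        no-sibling {s} s∈H s∉W attach ps = decidable-stable (nearM? m s) λ ¬near →
          let e , e∈W , se , e-far = sibling-child ps ¬near s∈H s∉W
          in fourth e∈W (λ { refl → e-far a-near }) (attach se)

        x-sibling : p ~ x → NearM m x
        x-sibling = no-sibling x∈H x∉W (inj₂ ∘ inj₁)

        y-sibling : p ~ y → NearM m y
        y-sibling = no-sibling y∈H y∉W (inj₂ ∘ inj₂)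

        -- By `fourth`, the first vertex beyond `s` lies outside `W`, so it is not simplicial either
        -- and `beyond` can be applied a second time.
        find-tail : ∀ {s} → s ∈ H → s ∉ W → (∀ {w} → s ~ w → a ~ w ⊎ x ~ w ⊎ y ~ w) → p ~ s → p ≡ a →
                    ∃[ s₁ ] ∃[ s₂ ] Tail s p s₁ s₂
        find-tail {s} s∈H s∉W attach ps refl =
          let s₁ , s₁∈H , ss₁ , s₁-far = beyond (just p) s∈H s∉W ps
              s₂ , _ , s₁s₂ , s₂-far = beyond (just s) s₁∈H
                (λ s₁∈W → fourth s₁∈W (λ q → s₁-far (inj₁ (≡-sym q))) (attach ss₁)) ss₁
          in s₁ , s₂ , record { base = ss₁ ; end = s₁s₂ ; far₁ = s₁-far ; far₂ = s₂-far }

        -- Both `x` and `y` lie in the clique of `p` and its predecessor, hence are adjacent. The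
        -- tail at `p` consists of `v` and `d`.
        at-parent : p ≡ a → ⊥
        at-parent refl =
          let xy = ≢∧near⇒~ x≢y (nearM-join m (path-link P) ax ay (x-sibling ax) (y-sibling ay))
              _ , _ , tx = find-tail x∈H x∉W (inj₂ ∘ inj₁) ax refl
              _ , _ , ty = find-tail y∈H y∉W (inj₂ ∘ inj₂) ay refl
          in T3-free (tailed-triangle⇒T3 ax ay xy
               record { base = pv ; end = vd ; far₁ = v-not-near ; far₂ = d-far } tx ty)
          where
          v-not-near : ¬ Near x v
          v-not-near (inj₁ refl) = v-far (x-sibling ax)
          v-not-near (inj₂ xv) = ¬nearM-transfer m (path-link P) pv ax (~-sym xv) v-far (x-sibling ax)

        -- One of `x`, `y` differs from `p`. Maximality of the path makes it adjacent to `p`, hence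
        -- a sibling by `¬nearM-transfer`, against `no-sibling`.
        at-sibling : p ~ a → ⊥
        at-sibling pa with x Fin.≟ p
        ... | no x≢p = ¬nearM-transfer m (path-link P) pa px ax a-far (x-sibling px)
          where
          a-far : ¬ NearM m a
          a-far = ¬nearM-transfer m (path-link P) pv pa va v-far
          px : p ~ x
          px = ≢∧near⇒~ (λ q → x≢p (≡-sym q)) (decidable-stable (near? p x) λ ¬near →
            let Pa = extend P pa a-far a∈H in longest (extend Pa ax ¬near x∈H) x∉W (path-longer Pa))
        ... | yes refl = ¬nearM-transfer m (path-link P) pa py ay a-far (y-sibling py)
          where
          a-far : ¬ NearM m a
          a-far = ¬nearM-transfer m (path-link P) pv pa va v-far
          py : p ~ y
          py = ≢∧near⇒~ x≢y (decidable-stable (near? p y) λ ¬near →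
            let Pa = extend P pa a-far a∈H in longest (extend Pa ay ¬near y∈H) y∉W (path-longer Pa))

        no-third-vertices : ⊥
        no-third-vertices = [ at-parent , at-sibling ]′ a-near

    -- Since `pair v d` is not closed in `Z⁺`, some `z` is attached to it there. If `z` lies in the
    -- clique of `v` and its predecessor, `Siblings` refutes it; otherwise `z ∈ W` is the second
    -- descendant.
    second-descendant : ∀ {m S v} → Path m S v → v ∉ W → Longest ∣ S ∣ → Violation v → ¬ ¬ SecondDescendant m v
    second-descendant {m} {S} {v} P v∉W longest b ¬second
      with d , d∈H , vd , d-far ← beyond m (path-end P) v∉W (path-link P) = by-escape
      where
      open Tip P v∉W longest
      d∈W : d ∈ W
      d∈W = child∈W vd d∈H d-far
      open Core P v∉W longest d∈W vd d-far
      at-a : ∀ {S a} → Path m S v → Longest ∣ S ∣ → a ∈ X b → a ∈ Y b → v ~ a → NearM m a → a ≢ d → ⊥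
      -- A root is impossible here, since nothing is near its missing predecessor.
      at-a {a = a} (extend P₀ pv v-far _) longest₀ a∈X a∈Y va a-near a≢d =
        let x , x∈X , x∉Y , ax = third va a-near a≢d b a∈X a∈Y
            y , y∈Y , y∉X , ay = third va a-near a≢d (flip b) a∈Y a∈X
        in Siblings.no-third-vertices P₀ pv v-far longest₀ vd d-far (W⊆M b) (indM b)
             (X⊆M b a∈X) (X⊆M b x∈X) (Y⊆M b y∈Y) (λ x∈W → x∉Y (W⊆Y b x∈W)) (λ y∈W → y∉X (W⊆X b y∈W))
             (X⊆H b x∈X) (Y⊆H b y∈Y) (X⊆H b a∈X) va a-near ax ay (∉⇒≢ y∈Y x∉Y)
      at-z : ∀ {c z} → c ∈ pair v d → z ∈ Z⁺ b → z ∉ pair v d → c ~ z → ⊥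
      at-z {c} {z} c∈ z∈ z∉ cz with ∉⇒≢ (∈pair₁ v d) z∉ | ∉⇒≢ (∈pair₂ v d) z∉
      ... | z≢v | z≢d with Z⁺⊆ b z∈ z≢v | (v ~? z) ×-dec nearM? m z
      ...   | z∈X , z∈Y | yes (vz , z-near) = at-a P longest z∈X z∈Y vz z-near z≢d
      ...   | z∈X , z∈Y | no z-below with z ∈? W
      ...     | no z∉W = let vz = pair-edge c∈ cz (X⊆H b z∈X) z∉W z≢v
                         in z-below (vz , near-if-∉W vz (X⊆H b z∈X) z∉W)
      ...     | yes z∈W = ¬second record
                { d∈W = d∈W ; v~d = vd ; d-far = d-far ; z∈W = z∈W ; z≢v = z≢v ; z≢d = z≢d
                ; z-attached = attached ; z-below = z-below }
        where
        attached : v ~ z ⊎ d ~ z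
        attached with ∈pair⁻ v d c∈
        ... | inj₁ refl = inj₁ cz
        ... | inj₂ refl = inj₂ cz
      by-escape : ⊥
      by-escape with closed-or-escape (Z⁺ b) (pair v d)
      ... | inj₁ cl = not-closed b cl
      ... | inj₂ (c , z , c∈ , z∈ , z∉ , cz) = at-z c∈ z∈ z∉ cz

    module Pair {m S v} (P : Path m S v) (v∉W : v ∉ W) (longest : Longest ∣ S ∣) (s : SecondDescendant m v) where

      open Tip P v∉W longest
      open SecondDescendant s

      private
        C₃ : Subset (n G)
        C₃ = pair v d ⊕ z

      -- The triple `v`, `d`, `z` is connected in `Z⁺`, so the vertex `x` of `X` attached to it is
      -- not in `Y`, hence not in `W`, and maximality of the path makes it a neighbour of `v`.
      third-upper : (b : Violation v) → ∃[ x ] (x ∈ X b × x ∉ Y b × v ~ x × NearM m x)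
      third-upper b
        with c , x , c∈ , x∈X , x∉ , cx ← growX b {C₃} (⊆⊕ (pair v d) z (∈pair₁ v d)) (∣triple∣≤3 v d z) =
        x , x∈X , x∉Y , vx , near-if-∉W vx x∈H x∉W
        where
        x∈H : x ∈ H
        x∈H = X⊆H b x∈X
        x≢d : x ≢ d
        x≢d = ∉⇒≢ (⊆⊕ (pair v d) z (∈pair₂ v d)) x∉
        x≢v : x ≢ v
        x≢v = X≢v b x∈X
        attached : v ~ x ⊎ d ~ x ⊎ z ~ x
        attached with ∈⊕⁻ (pair v d) z c∈
        ... | inj₂ refl = inj₂ (inj₂ cx)
        ... | inj₁ c∈′ with ∈pair⁻ v d c∈′
        ...   | inj₁ refl = inj₁ cx
        ...   | inj₂ refl = inj₂ (inj₁ cx)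
        x∉Y : x ∉ Y b
        x∉Y x∈Y = no-connected-4-set (indZ b) (v∈Z⁺ b) (W⊆Z⁺ b d∈W) (W⊆Z⁺ b z∈W) (XY⊆Z⁺ b x∈X x∈Y)
          v~d z-attached attached (λ q → z≢v (≡-sym q)) (λ q → z≢d (≡-sym q)) (λ q → x≢v (≡-sym q))
          (λ q → x≢d (≡-sym q)) (λ q → ∉⊕⇒≢ (pair v d) x∉ (≡-sym q))
        x∉W : x ∉ W
        x∉W x∈W = x∉Y (W⊆Y b x∈W)
        vx : v ~ x
        vx with attached
        ... | inj₁ e = e
        ... | inj₂ (inj₁ dx) = child-edge v~d (W⊆H d∈W) d-far dx x∈H x∉W x≢v
        ... | inj₂ (inj₂ zx) with v ~? z
        ...   | yes vz = child-edge vz (W⊆H z∈W) (λ near → z-below (vz , near)) zx x∈H x∉W x≢v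
        ...   | no ¬vz = grandchild-edge v~d (W⊆H d∈W) d-far ([ (λ vz → ⊥-elim (¬vz vz)) , id ]′ z-attached) (W⊆H z∈W)
                  [ (λ q → z≢v (≡-sym q)) , ¬vz ]′ zx x∈H x∉W x≢v x≢d

    -- A sibling x of v adjacent to y ∉ W has a single W-descendant: x, y and two of them would be
    -- connected within X ∪ Y.
    no-sibling-pair : ∀ {m S p v x y M} → Path m S p → p ~ v → ¬ NearM m v → Longest ∣ S ⊕ p ∣ →
      W ⊆ M → Ind G 3 M → x ∈ M → y ∈ M → x ∈ H → x ∉ W → y ∉ W → v ~ x → Near p x → x ≢ p → x ~ y → ⊥
    no-sibling-pair {m} {p = p} {x = x} {y} P pv v-far longest W⊆M indM x∈M y∈M x∈H x∉W y∉W vx x-near x≢p xy =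
      violated x∈H x∉W λ b′ → second-descendant (extend P px x-far x∈H) x∉W longest b′ λ s →
        let open SecondDescendant s in
        no-connected-4-set indM x∈M y∈M (W⊆M d∈W) (W⊆M z∈W) xy (inj₁ v~d)
          ([ inj₁ , inj₂ ∘ inj₂ ]′ z-attached)
          (~⇒≢ v~d) (λ { refl → y∉W d∈W }) (λ q → z≢v (≡-sym q)) (λ { refl → y∉W z∈W }) (λ q → z≢d (≡-sym q))
      where
      px : p ~ x
      px = ≢∧near⇒~ (λ q → x≢p (≡-sym q)) x-near
      x-far : ¬ NearM m x
      x-far = ¬nearM-transfer m (path-link P) pv px vx v-far

    -- Applying `third-upper` to both sides of the violation gives adjacent vertices `x` and `y`
    -- near the parent of `v`. At least one differs from the parent and is a sibling, to which
    -- `no-sibling-pair` applies.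
    no-longest-path : ∀ {m S v} → Path m S v → v ∉ W → ¬ Longest ∣ S ∣
    no-longest-path {m} {S} {v} P v∉W longest = violated (path-end P) v∉W λ b →
      second-descendant P v∉W longest b λ s →
        let x , x∈X , x∉Y , vx , x-near = Pair.third-upper P v∉W longest s b
            y , y∈Y , y∉X , vy , y-near = Pair.third-upper P v∉W longest s (flip b)
        in contradict P longest (W⊆M b) (indM b) (X⊆M b x∈X) (Y⊆M b y∈Y) (X⊆H b x∈X) (Y⊆H b y∈Y)
             (λ x∈W → x∉Y (W⊆Y b x∈W)) (λ y∈W → y∉X (W⊆X b y∈W)) vx vy x-near y-near (∉⇒≢ y∈Y x∉Y)
      where
      contradict : ∀ {m S x y M} → Path m S v → Longest ∣ S ∣ → W ⊆ M → Ind G 3 M → x ∈ M → y ∈ M → x ∈ H → y ∈ H →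
        x ∉ W → y ∉ W → v ~ x → v ~ y → NearM m x → NearM m y → x ≢ y → ⊥
      contradict {x = x} {y} P@(extend {v = p} P₀ pv v-far _) longest W⊆M indM x∈M y∈M x∈H y∈H x∉W y∉W vx vy x-near y-near x≢y
        with ≢∧near⇒~ x≢y (near-join (~-sym pv) vx vy x-near y-near) | x Fin.≟ p
      ... | xy | no x≢p = no-sibling-pair P₀ pv v-far longest W⊆M indM x∈M y∈M x∈H x∉W y∉W vx x-near x≢p xy
      ... | xy | yes refl = no-sibling-pair P₀ pv v-far longest W⊆M indM y∈M x∈M y∈H y∉W x∉W vy y-near
              (λ q → x≢y (≡-sym q)) (~-sym xy)

    -- Replaces the choice of a longest path by induction downwards from `n G`: a path with more
    -- than `k` earlier vertices is longest by the induction hypothesis at its own length.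
    no-path : ∀ k → Longest k
    no-path k = descend (n G) k (m≤n+m (n G) k)
      where
      descend : ∀ j k → n G ≤ k + j → Longest k
      descend zero k n≤ {S = S} _ _ k<S =
        contradiction (≤-trans (∣p∣≤n S) (subst (n G ≤_) (+-identityʳ k) n≤)) (<⇒≱ k<S)
      descend (suc j) k n≤ {S = S} P v∉W k<S =
        no-longest-path P v∉W (descend j ∣ S ∣ (≤-trans (subst (n G ≤_) (+-suc k j) n≤) (+-monoˡ-≤ j k<S)))

    all-in-W : ∀ {u} → u ∈ H → ¬ (u ∉ W)
    all-in-W u∈H u∉W = no-longest-path (start u∈H) u∉W (no-path _)

theorem4p10 : (G : Graph) → IsBlockGraph G → T3Free G → Shellable (Ind G 3)
theorem4p10 G block T3-free =
  Chordal.chordal⇒shellable (Ind G 3) (independent? 3) (independent-⊆ 3)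
    (λ W⊆V _ u∈V u∉W none → Minor.all-in-W G block T3-free W⊆V none u∈V u∉W)
    (independent-∅ 3)
  where open Independence G
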